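{- For every positive integer $k$, $$\zeta\left(\bar1,\{1\}_{k-1},3,\{1\}_{k-1}\right)=-\sum_{i=1}^{k-1}\frac{(\ln2)^i}{i!}\,\zeta\left(\bar1,\{1\}_{k-i-1},3,\{1\}_{k-1}\right)-\frac{(\ln2)^k}{k!}\,\zeta\left(\bar3,\{1\}_{k-1}\right)+\frac{(-1)^k}{2}\,\zeta\left(\bar2,\{1\}_{k-1}\right)^2 .$$
   Context: Notation. $\{1\}_r$ denotes the string of $r$ entries equal to $1$ (empty if $r=0$). For positive integers $s_1,\dots,s_r$, $\zeta(s_1,\dots,s_r):=\lim_{n\to\infty}\sum_{n\ge k_1>\cdots>k_r\ge1}\frac{1}{k_1^{s_1}\cdots k_r^{s_r}}$. A bar over an entry $s_j$ means that the factor $(-1)^{k_j}$ is inserted in the summand; e.g. $\zeta(\bar1,\{1\}_{m-1},3,\{1\}_{k-1})=\lim_{n\to\infty}\sum_{n\ge k_1>\cdots>k_{m+k}\ge1}\frac{(-1)^{k_1}}{k_1\cdots k_m\,k_{m+1}^3\,k_{m+2}\cdots k_{m+k}}$. Sums over empty ranges are $0$. -}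

module Defs where

open import Data.Empty using (⊥-elim)
open import Data.Integer.Base as ℤ using (+_; -[1+_]; -1ℤ)
import Data.Integer.Properties as ℤ
open import Data.List.Base using (List; []; _∷_; length; replicate)
open import Data.Nat.Base as ℕ using (ℕ; zero; suc; NonZero; _!)
import Data.Nat.Coprimality as Coprimality
open import Data.Nat.Properties as ℕ using (_!≢0; m^n≢0)
open import Data.Product.Base using (∃; _×_; _,_; proj₁; proj₂)
open import Data.Rational.Base as ℚ
  using (ℚ; mkℚ; 0ℚ; 1ℚ; ½; _/_; _+_; _*_; _-_; -_; ∣_∣; _≤_; _<_; *<*; Positive)
open import Data.Rational.Properties
import Data.Rational.Solver
import Data.Rational.Unnormalised.Base as ℚᵘ
import Data.Rational.Unnormalised.Properties as ℚᵘ
open import Data.Sum.Base using (inj₁; inj₂)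
open import Data.Unit.Base using (⊤)
open import Relation.Binary.PropositionalEquality
  using (_≡_; refl; sym; trans; cong; cong₂; subst; subst₂; module ≡-Reasoning)

open Data.Rational.Solver.+-*-Solver
  using (solve; _:=_; _:+_; _:*_; _:-_; :-_; con)

-- Real numbers as Cauchy sequences of rationals. The real represented
-- by a sequence is its limit, so two sequences represent the same real
-- when their difference tends to 0.

Null : (ℕ → ℚ) → Set
Null a = ∀ ε → 0ℚ < ε → ∃ λ N → ∀ n → N ℕ.≤ n → ∣ a n ∣ < ε

Cauchy : (ℕ → ℚ) → Set
Cauchy a =
  ∀ ε → 0ℚ < ε → ∃ λ N → ∀ m n → N ℕ.≤ m → N ℕ.≤ n → ∣ a m - a n ∣ < ε

record ℝ : Set where
  constructor lim
  field
    seq    : ℕ → ℚ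
    cauchy : Cauchy seq

open ℝ public

infix 4 _≃ℝ_

_≃ℝ_ : ℝ → ℝ → Set
x ≃ℝ y = Null (λ n → seq x n - seq y n)

∣p-q∣≡∣q-p∣ : ∀ p q → ∣ p - q ∣ ≡ ∣ q - p ∣
∣p-q∣≡∣q-p∣ p q =
  trans (sym (∣-p∣≡∣p∣ (p - q)))
        (cong ∣_∣ (solve 2 (λ p q → :- (p :- q) := q :- p) refl p q))

p≤∣p∣ : ∀ p → p ≤ ∣ p ∣
p≤∣p∣ p with ≤-total 0ℚ p
... | inj₁ 0≤p = ≤-reflexive (sym (0≤p⇒∣p∣≡p 0≤p))
... | inj₂ p≤0 = ≤-trans p≤0 (0≤∣p∣ p)

+-nonNeg : ∀ {p q} → 0ℚ ≤ p → 0ℚ ≤ q → 0ℚ ≤ p + q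
+-nonNeg = +-mono-≤

*-nonNeg : ∀ {p q} → 0ℚ ≤ p → 0ℚ ≤ q → 0ℚ ≤ p * q
*-nonNeg {p} {q} 0≤p 0≤q = subst (_≤ p * q) (*-zeroˡ q)
  (*-monoʳ-≤-nonNeg q {{ℚ.nonNegative 0≤q}} 0≤p)

*-mono : ∀ {p q r s} → 0ℚ ≤ r → 0ℚ ≤ q → p ≤ q → r ≤ s → p * r ≤ q * s
*-mono {p} {q} {r} {s} 0≤r 0≤q p≤q r≤s = ≤-trans
  (*-monoʳ-≤-nonNeg r {{ℚ.nonNegative 0≤r}} p≤q)
  (*-monoˡ-≤-nonNeg q {{ℚ.nonNegative 0≤q}} r≤s)

p≤q⇒0≤q-p : ∀ {p q} → p ≤ q → 0ℚ ≤ q - p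
p≤q⇒0≤q-p {p} {q} p≤q =
  subst (_≤ q - p) (+-inverseʳ p) (+-monoˡ-≤ (- p) p≤q)

0≤q-p⇒p≤q : ∀ {p q} → 0ℚ ≤ q - p → p ≤ q
0≤q-p⇒p≤q {p} {q} 0≤q-p = subst₂ _≤_ (+-identityˡ p)
  (solve 2 (λ p q → (q :- p) :+ p := q) refl p q) (+-monoˡ-≤ p 0≤q-p)

p≤p+q : ∀ {p q} → 0ℚ ≤ q → p ≤ p + q
p≤p+q {p} {q} 0≤q = subst (_≤ p + q) (+-identityʳ p) (+-monoʳ-≤ p 0≤q)

p-q≤p : ∀ {p q} → 0ℚ ≤ q → p - q ≤ p
p-q≤p {p} {q} 0≤q =
  subst (p - q ≤_) (+-identityʳ p) (+-monoʳ-≤ p (neg-antimono-≤ 0≤q))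

half : ∀ p → ½ * p + ½ * p ≡ p
half p = trans (sym (*-distribʳ-+ p ½ ½)) (*-identityˡ p)

0<½p : ∀ {p} → 0ℚ < p → 0ℚ < ½ * p
0<½p {p} 0<p = positive⁻¹ (½ * p) {{pos*pos⇒pos ½ p {{ℚ.positive 0<p}}}}

quotient : ∀ b ε → 0ℚ < b → 0ℚ < ε → ∃ λ δ → 0ℚ < δ × b * δ ≡ ε
quotient b ε 0<b 0<ε = δ , positive⁻¹ δ {{pos*pos⇒pos (ℚ.1/ b) {{1/pos⇒pos b}} ε}} , eq
  where
  instance
    b-pos : Positive b
    b-pos = ℚ.positive 0<b
    ε-pos : Positive ε
    ε-pos = ℚ.positive 0<ε
    b≢0 : ℚ.NonZero b
    b≢0 = pos⇒nonZero b
  δ = ℚ.1/ b * ε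
  eq : b * δ ≡ ε
  eq = trans (sym (*-assoc b (ℚ.1/ b) ε))
             (trans (cong (_* ε) (*-inverseʳ b)) (*-identityˡ ε))

0<1 : 0ℚ < 1ℚ
0<1 = positive⁻¹ 1ℚ

null-+ : ∀ {a b : ℕ → ℚ} → Null a → Null b → Null (λ n → a n + b n)
null-+ {a} {b} a→0 b→0 ε 0<ε
  with a→0 (½ * ε) (0<½p 0<ε) | b→0 (½ * ε) (0<½p 0<ε)
... | M , p | N , q = M ℕ.⊔ N , λ n le → begin-strict
  ∣ a n + b n ∣      ≤⟨ ∣p+q∣≤∣p∣+∣q∣ (a n) (b n) ⟩
  ∣ a n ∣ + ∣ b n ∣  <⟨ +-mono-< (p n (ℕ.≤-trans (ℕ.m≤m⊔n M N) le))
                                 (q n (ℕ.≤-trans (ℕ.m≤n⊔m M N) le)) ⟩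
  ½ * ε + ½ * ε      ≡⟨ half ε ⟩
  ε                  ∎
  where open ≤-Reasoning

null-scale : ∀ c {a : ℕ → ℚ} → Null a → Null (λ n → c * a n)
null-scale c {a} a→0 = go (∣ c ∣ + 1ℚ) (+-mono-≤-< (0≤∣p∣ c) 0<1) (p≤p+q (<⇒≤ 0<1))
  where
  go : ∀ b → 0ℚ < b → ∣ c ∣ ≤ b → Null (λ n → c * a n)
  go b 0<b ∣c∣≤b ε 0<ε with quotient b ε 0<b 0<ε
  ... | δ , 0<δ , eq with a→0 δ 0<δ
  ... | N , p = N , λ n le → begin-strict
    ∣ c * a n ∣      ≡⟨ ∣p*q∣≡∣p∣*∣q∣ c (a n) ⟩
    ∣ c ∣ * ∣ a n ∣  ≤⟨ *-monoʳ-≤-nonNeg ∣ a n ∣ {{∣-∣-nonNeg (a n)}} ∣c∣≤b ⟩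
    b * ∣ a n ∣      <⟨ *-monoʳ-<-pos b {{ℚ.positive 0<b}} (p n le) ⟩
    b * δ            ≡⟨ eq ⟩
    ε                ∎
    where open ≤-Reasoning

bounded⇒cauchy : ∀ {a g : ℕ → ℚ} → Null g →
  (∀ n d → ∣ a (d ℕ.+ n) - a n ∣ ≤ g n) → Cauchy a
bounded⇒cauchy {a} {g} g→0 bound ε 0<ε with g→0 ε 0<ε
... | N , p = N , close
  where
  close′ : ∀ m n → N ℕ.≤ n → n ℕ.≤ m → ∣ a m - a n ∣ < ε
  close′ m n N≤n n≤m = ≤-<-trans
    (≤-trans (subst (λ k → ∣ a k - a n ∣ ≤ g n) (ℕ.m∸n+n≡m n≤m) (bound n (m ℕ.∸ n)))
             (p≤∣p∣ (g n)))
    (p n N≤n)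
  close : ∀ m n → N ℕ.≤ m → N ℕ.≤ n → ∣ a m - a n ∣ < ε
  close m n N≤m N≤n with ℕ.≤-total n m
  ... | inj₁ n≤m = close′ m n N≤n n≤m
  ... | inj₂ m≤n = subst (_< ε) (∣p-q∣≡∣q-p∣ (a n) (a m)) (close′ n m N≤m m≤n)

telescope : ∀ {a f : ℕ → ℚ} → (∀ n → ∣ a (suc n) - a n ∣ ≤ f n - f (suc n)) →
  ∀ n d → ∣ a (d ℕ.+ n) - a n ∣ ≤ f n - f (d ℕ.+ n)
telescope {a} {f} step n zero = ≤-reflexive
  (trans (cong ∣_∣ (+-inverseʳ (a n))) (sym (+-inverseʳ (f n))))
telescope {a} {f} step n (suc d) = begin
  ∣ a (suc k) - a n ∣                    ≡⟨ cong ∣_∣ (split (a (suc k)) (a k) (a n)) ⟩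
  ∣ (a (suc k) - a k) + (a k - a n) ∣    ≤⟨ ∣p+q∣≤∣p∣+∣q∣ (a (suc k) - a k) (a k - a n) ⟩
  ∣ a (suc k) - a k ∣ + ∣ a k - a n ∣    ≤⟨ +-mono-≤ (step k) (telescope {a} {f} step n d) ⟩
  (f k - f (suc k)) + (f n - f k)        ≡⟨ solve 3 (λ x y z → (x :- y) :+ (z :- x) := z :- y) refl (f k) (f (suc k)) (f n) ⟩
  f n - f (suc k)                        ∎
  where
  open ≤-Reasoning
  k = d ℕ.+ n
  split : ∀ x y z → x - z ≡ (x - y) + (y - z)
  split = solve 3 (λ x y z → x :- z := (x :- y) :+ (y :- z)) refl

telescope⇒cauchy : ∀ {a f : ℕ → ℚ} → (∀ n → 0ℚ ≤ f n) → Null f →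
  (∀ n → ∣ a (suc n) - a n ∣ ≤ f n - f (suc n)) → Cauchy a
telescope⇒cauchy {a} {f} 0≤f f→0 step = bounded⇒cauchy {a} {f} f→0
  (λ n d → ≤-trans (telescope {a} {f} step n d) (p-q≤p (0≤f (d ℕ.+ n))))

eventually-bounded : ∀ {a : ℕ → ℚ} → Cauchy a →
  ∃ λ b → ∃ λ N → 0ℚ ≤ b × (∀ n → N ℕ.≤ n → ∣ a n ∣ ≤ b)
eventually-bounded {a} a-cauchy with a-cauchy 1ℚ 0<1
... | N , p = 1ℚ + ∣ a N ∣ , N , +-nonNeg (<⇒≤ 0<1) (0≤∣p∣ (a N)) , λ n le → begin
  ∣ a n ∣                    ≡⟨ cong ∣_∣ (solve 2 (λ x y → x := (x :- y) :+ y) refl (a n) (a N)) ⟩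
  ∣ (a n - a N) + a N ∣      ≤⟨ ∣p+q∣≤∣p∣+∣q∣ (a n - a N) (a N) ⟩
  ∣ a n - a N ∣ + ∣ a N ∣    ≤⟨ +-monoˡ-≤ ∣ a N ∣ (<⇒≤ (p n N le ℕ.≤-refl)) ⟩
  1ℚ + ∣ a N ∣               ∎
  where open ≤-Reasoning

cauchy-const : ∀ q → Cauchy (λ _ → q)
cauchy-const q ε 0<ε = 0 , λ _ _ _ _ → subst (_< ε) (sym (cong ∣_∣ (+-inverseʳ q))) 0<ε

cauchy-+ : ∀ {a b : ℕ → ℚ} → Cauchy a → Cauchy b → Cauchy (λ n → a n + b n)
cauchy-+ {a} {b} a-cauchy b-cauchy ε 0<ε
  with a-cauchy (½ * ε) (0<½p 0<ε) | b-cauchy (½ * ε) (0<½p 0<ε)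
... | M , p | N , q = M ℕ.⊔ N , λ m n le le′ → begin-strict
  ∣ (a m + b m) - (a n + b n) ∣      ≡⟨ cong ∣_∣ (solve 4 (λ x y z w → (x :+ y) :- (z :+ w) := (x :- z) :+ (y :- w)) refl (a m) (b m) (a n) (b n)) ⟩
  ∣ (a m - a n) + (b m - b n) ∣      ≤⟨ ∣p+q∣≤∣p∣+∣q∣ (a m - a n) (b m - b n) ⟩
  ∣ a m - a n ∣ + ∣ b m - b n ∣      <⟨ +-mono-< (p m n (ℕ.≤-trans (ℕ.m≤m⊔n M N) le) (ℕ.≤-trans (ℕ.m≤m⊔n M N) le′))
                                                 (q m n (ℕ.≤-trans (ℕ.m≤n⊔m M N) le) (ℕ.≤-trans (ℕ.m≤n⊔m M N) le′)) ⟩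
  ½ * ε + ½ * ε                      ≡⟨ half ε ⟩
  ε                                  ∎
  where open ≤-Reasoning

cauchy-neg : ∀ {a : ℕ → ℚ} → Cauchy a → Cauchy (λ n → - a n)
cauchy-neg {a} a-cauchy ε 0<ε with a-cauchy ε 0<ε
... | N , p = N , λ m n le le′ → subst (_< ε)
  (trans (∣p-q∣≡∣q-p∣ (a m) (a n))
         (cong ∣_∣ (solve 2 (λ x y → y :- x := (:- x) :- (:- y)) refl (a m) (a n))))
  (p m n le le′)

cauchy-* : ∀ {a b : ℕ → ℚ} → Cauchy a → Cauchy b → Cauchy (λ n → a n * b n)
cauchy-* {a} {b} a-cauchy b-cauchy = go
  (eventually-bounded {a} a-cauchy) (eventually-bounded {b} b-cauchy)
  where
  Bounded : (ℕ → ℚ) → Set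
  Bounded a = ∃ λ b → ∃ λ N → 0ℚ ≤ b × (∀ n → N ℕ.≤ n → ∣ a n ∣ ≤ b)
  go : Bounded a → Bounded b → Cauchy (λ n → a n * b n)
  go (A , M₁ , 0≤A , ∣a∣≤A) (B , M₂ , 0≤B , ∣b∣≤B) =
    close (A + B + 1ℚ) (+-mono-≤-< (+-nonNeg 0≤A 0≤B) 0<1)
      (subst (_< A + B + 1ℚ) (+-identityʳ (A + B)) (+-monoʳ-< (A + B) 0<1))
    where
    close : ∀ C → 0ℚ < C → A + B < C → Cauchy (λ n → a n * b n)
    close C 0<C A+B<C ε 0<ε with quotient C ε 0<C 0<ε
    ... | δ , 0<δ , eq with a-cauchy δ 0<δ | b-cauchy δ 0<δ
    ... | N₁ , p | N₂ , q = M ℕ.⊔ N , λ m n le le′ → begin-strict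
      ∣ a m * b m - a n * b n ∣
        ≡⟨ cong ∣_∣ (solve 4 (λ x y z w → x :* y :- z :* w := x :* (y :- w) :+ (x :- z) :* w) refl (a m) (b m) (a n) (b n)) ⟩
      ∣ a m * (b m - b n) + (a m - a n) * b n ∣
        ≤⟨ ∣p+q∣≤∣p∣+∣q∣ (a m * (b m - b n)) ((a m - a n) * b n) ⟩
      ∣ a m * (b m - b n) ∣ + ∣ (a m - a n) * b n ∣
        ≡⟨ cong₂ _+_ (∣p*q∣≡∣p∣*∣q∣ (a m) (b m - b n)) (∣p*q∣≡∣p∣*∣q∣ (a m - a n) (b n)) ⟩
      ∣ a m ∣ * ∣ b m - b n ∣ + ∣ a m - a n ∣ * ∣ b n ∣
        ≤⟨ +-mono-≤
             (*-mono (0≤∣p∣ (b m - b n)) 0≤A (∣a∣≤A m (M₁≤ le)) (<⇒≤ (q m n (N₂≤ le) (N₂≤ le′))))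
             (*-mono (0≤∣p∣ (b n)) (<⇒≤ 0<δ) (<⇒≤ (p m n (N₁≤ le) (N₁≤ le′))) (∣b∣≤B n (M₂≤ le′))) ⟩
      A * δ + δ * B
        ≡⟨ solve 3 (λ A B δ → A :* δ :+ δ :* B := (A :+ B) :* δ) refl A B δ ⟩
      (A + B) * δ
        <⟨ *-monoˡ-<-pos δ {{ℚ.positive 0<δ}} A+B<C ⟩
      C * δ
        ≡⟨ eq ⟩
      ε ∎
      where
      open ≤-Reasoning
      M = M₁ ℕ.⊔ M₂
      N = N₁ ℕ.⊔ N₂
      M₁≤ : ∀ {k} → M ℕ.⊔ N ℕ.≤ k → M₁ ℕ.≤ k
      M₁≤ le = ℕ.≤-trans (ℕ.≤-trans (ℕ.m≤m⊔n M₁ M₂) (ℕ.m≤m⊔n M N)) le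
      M₂≤ : ∀ {k} → M ℕ.⊔ N ℕ.≤ k → M₂ ℕ.≤ k
      M₂≤ le = ℕ.≤-trans (ℕ.≤-trans (ℕ.m≤n⊔m M₁ M₂) (ℕ.m≤m⊔n M N)) le
      N₁≤ : ∀ {k} → M ℕ.⊔ N ℕ.≤ k → N₁ ℕ.≤ k
      N₁≤ le = ℕ.≤-trans (ℕ.≤-trans (ℕ.m≤m⊔n N₁ N₂) (ℕ.m≤n⊔m M N)) le
      N₂≤ : ∀ {k} → M ℕ.⊔ N ℕ.≤ k → N₂ ℕ.≤ k
      N₂≤ le = ℕ.≤-trans (ℕ.≤-trans (ℕ.m≤n⊔m N₁ N₂) (ℕ.m≤n⊔m M N)) le

fromℚ : ℚ → ℝ
fromℚ q = lim (λ _ → q) (cauchy-const q)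

infixl 6 _+ℝ_ _-ℝ_
infixl 7 _*ℝ_
infix  8 -ℝ_
infixr 8 _^ℝ_

_+ℝ_ : ℝ → ℝ → ℝ
x +ℝ y = lim (λ n → seq x n + seq y n) (cauchy-+ {seq x} {seq y} (cauchy x) (cauchy y))

-ℝ_ : ℝ → ℝ
-ℝ x = lim (λ n → - seq x n) (cauchy-neg {seq x} (cauchy x))

_-ℝ_ : ℝ → ℝ → ℝ
x -ℝ y = x +ℝ (-ℝ y)

_*ℝ_ : ℝ → ℝ → ℝ
x *ℝ y = lim (λ n → seq x n * seq y n) (cauchy-* {seq x} {seq y} (cauchy x) (cauchy y))

_^ℝ_ : ℝ → ℕ → ℝ
x ^ℝ zero  = fromℚ 1ℚ
x ^ℝ suc n = x *ℝ (x ^ℝ n)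

1/_! : ℕ → ℝ
1/ n ! = fromℚ ((+ 1 / (n !)) {{n !≢0}})

∑ℝ : ℕ → (ℕ → ℝ) → ℝ
∑ℝ zero    f = fromℚ 0ℚ
∑ℝ (suc n) f = ∑ℝ n f +ℝ f (suc n)

-- `bar s` is an exponent s written with a bar.
data Entry : Set where
  plain bar : (s : ℕ) → .{{NonZero s}} → Entry

factor : Entry → (k : ℕ) → .{{NonZero k}} → ℚ
factor (plain s) k = (+ 1 / (k ℕ.^ s)) {{m^n≢0 k s}}
factor (bar s)   k = ((-1ℤ ℤ.^ k) / (k ℕ.^ s)) {{m^n≢0 k s}}

-- The sum over n ≥ k₁ > ⋯ > kᵣ ≥ 1; the last clause splits off k₁ = suc n,
-- which leaves n ≥ k₂ > ⋯ > kᵣ ≥ 1.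
zetaSum : List Entry → ℕ → ℚ
zetaSum []       n       = 1ℚ
zetaSum (e ∷ es) zero    = 0ℚ
zetaSum (e ∷ es) (suc n) = zetaSum (e ∷ es) n + factor e (suc n) * zetaSum es n

-- The limit exists whenever the first entry is not an unbarred 1, whatever
-- the later entries are.
Convergent : List Entry → Set
Convergent []             = ⊤
Convergent (plain s ∷ es) = 2 ℕ.≤ s
Convergent (bar s   ∷ es) = ⊤

u : ℕ → ℚ
u n = + 1 / suc n

/-*-/ : ∀ i j a b .{{_ : NonZero a}} .{{_ : NonZero b}} .{{_ : NonZero (a ℕ.* b)}} →
  (i / a) * (j / b) ≡ (i ℤ.* j) / (a ℕ.* b)
/-*-/ i j (suc a) (suc b) = toℚᵘ-injective (begin
  ℚ.toℚᵘ ((i / suc a) * (j / suc b))           ≈⟨ toℚᵘ-homo-* (i / suc a) (j / suc b) ⟩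
  ℚ.toℚᵘ (i / suc a) ℚᵘ.* ℚ.toℚᵘ (j / suc b)   ≈⟨ ℚᵘ.*-cong (toℚᵘ-fromℚᵘ p) (toℚᵘ-fromℚᵘ q) ⟩
  p ℚᵘ.* q                                     ≈⟨ ℚᵘ.≃-sym (toℚᵘ-fromℚᵘ (p ℚᵘ.* q)) ⟩
  ℚ.toℚᵘ ((i ℤ.* j) / (suc a ℕ.* suc b))       ∎)
  where
  open import Relation.Binary.Reasoning.Setoid ℚᵘ.≃-setoid
  p = ℚᵘ.mkℚᵘ i a
  q = ℚᵘ.mkℚᵘ j b

/1-+-/1 : ∀ i j → (i / 1) + (j / 1) ≡ (i ℤ.+ j) / 1
/1-+-/1 i j = toℚᵘ-injective (begin
  ℚ.toℚᵘ ((i / 1) + (j / 1))             ≈⟨ toℚᵘ-homo-+ (i / 1) (j / 1) ⟩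
  ℚ.toℚᵘ (i / 1) ℚᵘ.+ ℚ.toℚᵘ (j / 1)     ≈⟨ ℚᵘ.+-cong (toℚᵘ-fromℚᵘ p) (toℚᵘ-fromℚᵘ q) ⟩
  p ℚᵘ.+ q                               ≡⟨ cong (λ k → ℚᵘ.mkℚᵘ k 0) (cong₂ ℤ._+_ (ℤ.*-identityʳ i) (ℤ.*-identityʳ j)) ⟩
  ℚᵘ.mkℚᵘ (i ℤ.+ j) 0                    ≈⟨ ℚᵘ.≃-sym (toℚᵘ-fromℚᵘ (ℚᵘ.mkℚᵘ (i ℤ.+ j) 0)) ⟩
  ℚ.toℚᵘ ((i ℤ.+ j) / 1)                 ∎)
  where
  open import Relation.Binary.Reasoning.Setoid ℚᵘ.≃-setoid
  p = ℚᵘ.mkℚᵘ i 0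
  q = ℚᵘ.mkℚᵘ j 0

n/n≡1 : ∀ n → + suc n / suc n ≡ 1ℚ
n/n≡1 n = fromℚᵘ-cong {ℚᵘ.mkℚᵘ (+ suc n) n} {ℚᵘ.mkℚᵘ (+ 1) 0}
  (ℚᵘ.*≡* (ℤ.*-comm (+ suc n) (+ 1)))

[1+n]/1 : ∀ n → + suc n / 1 ≡ + n / 1 + 1ℚ
[1+n]/1 n = trans (cong (λ k → + k / 1) (ℕ.+-comm 1 n)) (sym (/1-+-/1 (+ n) (+ 1)))

[1+n]*u : ∀ n → (+ suc n / 1) * u n ≡ 1ℚ
[1+n]*u n = trans (/-*-/ (+ suc n) (+ 1) 1 (suc n))
  (trans (/-cong {q₂ = suc n} (ℤ.*-identityʳ (+ suc n)) (ℕ.*-identityˡ (suc n))) (n/n≡1 n))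

0<u : ∀ n → 0ℚ < u n
0<u n = positive⁻¹ (u n) {{normalize-pos 1 (suc n)}}

0≤u : ∀ n → 0ℚ ≤ u n
0≤u n = <⇒≤ (0<u n)

u-diff : ∀ n → u n - u (suc n) ≡ u n * u (suc n)
u-diff n = begin
  p - q                        ≡⟨ cong₂ _-_ (sym (*-identityʳ p)) (sym (*-identityʳ q)) ⟩
  p * 1ℚ - q * 1ℚ              ≡⟨ cong₂ (λ s t → p * s - q * t) (sym ([1+n]*u (suc n))) (sym ([1+n]*u n)) ⟩
  p * (y * q) - q * (x * p)    ≡⟨ cong (λ t → p * (t * q) - q * (x * p)) ([1+n]/1 (suc n)) ⟩
  p * ((x + 1ℚ) * q) - q * (x * p)
    ≡⟨ solve 3 (λ p q x → p :* ((x :+ con 1ℚ) :* q) :- q :* (x :* p) := p :* q) refl p q x ⟩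
  p * q                        ∎
  where
  open ≡-Reasoning
  p = u n
  q = u (suc n)
  x = + suc n / 1
  y = + suc (suc n) / 1

u-suc≤u : ∀ n → u (suc n) ≤ u n
u-suc≤u n = 0≤q-p⇒p≤q
  (subst (0ℚ ≤_) (sym (u-diff n)) (*-nonNeg (0≤u n) (0≤u (suc n))))

u≤1 : ∀ n → u n ≤ 1ℚ
u≤1 zero    = ≤-refl
u≤1 (suc n) = ≤-trans (u-suc≤u n) (u≤1 n)

u≤2u-suc : ∀ n → u n ≤ u (suc n) + u (suc n)
u≤2u-suc n = begin
  p            ≡⟨ solve 2 (λ p q → p := q :+ (p :- q)) refl p q ⟩
  q + (p - q)  ≡⟨ cong (_+_ q) (u-diff n) ⟩
  q + p * q    ≤⟨ +-monoʳ-≤ q (*-monoʳ-≤-nonNeg q {{ℚ.nonNegative (0≤u (suc n))}} (u≤1 n)) ⟩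
  q + 1ℚ * q   ≡⟨ cong (_+_ q) (*-identityˡ q) ⟩
  q + q        ∎
  where
  open ≤-Reasoning
  p = u n
  q = u (suc n)

u-antitone : ∀ {m n} → m ℕ.≤ n → u n ≤ u m
u-antitone {m} {n} m≤n = subst (λ k → u k ≤ u m) (ℕ.m∸n+n≡m m≤n) (go (n ℕ.∸ m))
  where
  go : ∀ d → u (d ℕ.+ m) ≤ u m
  go zero    = ≤-refl
  go (suc d) = ≤-trans (u-suc≤u (d ℕ.+ m)) (go d)

u-archimedean : ∀ ε → 0ℚ < ε → ∃ λ N → u N < ε
u-archimedean ε@(mkℚ (+ 0) d c) 0<ε = ⊥-elim (<-irrefl (sym (↥p≡0⇒p≡0 ε refl)) 0<ε)
u-archimedean ε@(mkℚ -[1+ a ] d c) 0<ε = ⊥-elim (<-irrefl refl (<-trans 0<ε (negative⁻¹ ε)))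
u-archimedean ε@(mkℚ (+ suc a) d c) 0<ε = suc d , subst (_< ε)
  (sym (normalize-coprime (Coprimality.1-coprimeTo (suc (suc d)))))
  (*<* (subst₂ ℤ._<_ (sym (ℤ.*-identityˡ (+ suc d))) (ℤ.pos-* (suc a) (suc (suc d)))
    (ℤ.+<+ (ℕ.<-≤-trans (ℕ.n<1+n (suc d)) (ℕ.m≤n*m (suc (suc d)) (suc a))))))

null-u : Null u
null-u ε 0<ε with u-archimedean ε 0<ε
... | N , p = N , λ n N≤n →
  subst (_< ε) (sym (0≤p⇒∣p∣≡p (0≤u n))) (≤-<-trans (u-antitone N≤n) p)

cesàro : (p g : ℕ → ℚ) → (∀ n → 0ℚ ≤ p n) → (∀ n → p (suc n) ≡ p n + g n) →
  Null g → Null (λ n → p n * u n)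
cesàro p g 0≤p p-suc g→0 ε 0<ε = conclude (g→0 δ (0<½p 0<ε))
  where
  open ≤-Reasoning
  δ = ½ * ε
  0≤δ : 0ℚ ≤ δ
  0≤δ = <⇒≤ (0<½p 0<ε)
  module _ (N : ℕ) (g<δ : ∀ n → N ℕ.≤ n → ∣ g n ∣ < δ) where
    grow : ∀ d → p (d ℕ.+ N) ≤ p N + (+ (d ℕ.+ N) / 1) * δ
    grow zero = p≤p+q (*-nonNeg
      (nonNegative⁻¹ (+ N / 1) {{normalize-nonNeg N 1}}) 0≤δ)
    grow (suc d) = begin
      p (suc k)                          ≡⟨ p-suc k ⟩
      p k + g k                          ≤⟨ +-mono-≤ (grow d) (≤-trans (p≤∣p∣ (g k)) (<⇒≤ (g<δ k (ℕ.m≤n+m N d)))) ⟩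
      (p N + (+ k / 1) * δ) + δ          ≡⟨ solve 3 (λ a x δ → (a :+ x :* δ) :+ δ := a :+ (x :+ con 1ℚ) :* δ) refl (p N) (+ k / 1) δ ⟩
      p N + (+ k / 1 + 1ℚ) * δ           ≡⟨ cong (λ x → p N + x * δ) (sym ([1+n]/1 k)) ⟩
      p N + (+ suc k / 1) * δ            ∎
      where k = d ℕ.+ N
    close : ∀ M → (∀ n → M ℕ.≤ n → ∣ p N * u n ∣ < δ) →
      ∀ n → M ℕ.⊔ N ℕ.≤ n → ∣ p n * u n ∣ < ε
    close M pNu<δ n le = begin-strict
      ∣ p n * u n ∣                      ≡⟨ 0≤p⇒∣p∣≡p (*-nonNeg (0≤p n) (0≤u n)) ⟩
      p n * u n                          ≤⟨ *-monoʳ-≤-nonNeg (u n) {{ℚ.nonNegative (0≤u n)}} pn≤ ⟩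
      (p N + (+ suc n / 1) * δ) * u n    ≡⟨ solve 4 (λ a x δ v → (a :+ x :* δ) :* v := a :* v :+ (x :* v) :* δ) refl (p N) (+ suc n / 1) δ (u n) ⟩
      p N * u n + ((+ suc n / 1) * u n) * δ
        ≡⟨ cong (λ t → p N * u n + t * δ) ([1+n]*u n) ⟩
      p N * u n + 1ℚ * δ                 ≡⟨ cong (_+_ (p N * u n)) (*-identityˡ δ) ⟩
      p N * u n + δ                      <⟨ +-monoˡ-< δ (≤-<-trans (p≤∣p∣ (p N * u n)) (pNu<δ n (ℕ.≤-trans (ℕ.m≤m⊔n M N) le))) ⟩
      δ + δ                              ≡⟨ half ε ⟩
      ε                                  ∎
      where
      pn≤ : p n ≤ p N + (+ suc n / 1) * δ
      pn≤ = begin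
        p n                            ≤⟨ subst (λ k → p k ≤ p N + (+ k / 1) * δ)
                                            (ℕ.m∸n+n≡m (ℕ.≤-trans (ℕ.m≤n⊔m M N) le)) (grow (n ℕ.∸ N)) ⟩
        p N + (+ n / 1) * δ            ≤⟨ +-monoʳ-≤ (p N) (*-monoʳ-≤-nonNeg δ {{ℚ.nonNegative 0≤δ}}
                                            (subst (+ n / 1 ≤_) (sym ([1+n]/1 n)) (p≤p+q (<⇒≤ 0<1)))) ⟩
        p N + (+ suc n / 1) * δ        ∎
    finish : (∃ λ M → ∀ n → M ℕ.≤ n → ∣ p N * u n ∣ < δ) →
      ∃ λ K → ∀ n → K ℕ.≤ n → ∣ p n * u n ∣ < ε
    finish (M , pNu<δ) = M ℕ.⊔ N , close M pNu<δ
  conclude : (∃ λ N → ∀ n → N ℕ.≤ n → ∣ g n ∣ < δ) →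
    ∃ λ K → ∀ n → K ℕ.≤ n → ∣ p n * u n ∣ < ε
  conclude (N , g<δ) = finish N g<δ (null-scale (p N) {u} null-u δ (0<½p 0<ε))

-- The sums A j n over n ≥ k₁ > ⋯ > kⱼ ≥ 1 of 1 / (k₁ ⋯ kⱼ), which bound
-- all sums of depth j, and F j, for which F j n - F j (suc n) equals
-- A j n / ((n + 1) (n + 2)).

A : ℕ → ℕ → ℚ
A zero    n       = 1ℚ
A (suc j) zero    = 0ℚ
A (suc j) (suc n) = A (suc j) n + A j n * u n

F : ℕ → ℕ → ℚ
F zero    n = A zero n * u n
F (suc j) n = F j n + A (suc j) n * u n

0≤A : ∀ j n → 0ℚ ≤ A j n
0≤A zero    n       = <⇒≤ 0<1
0≤A (suc j) zero    = ≤-refl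
0≤A (suc j) (suc n) = +-nonNeg (0≤A (suc j) n) (*-nonNeg (0≤A j n) (0≤u n))

0≤Au : ∀ j n → 0ℚ ≤ A j n * u n
0≤Au j n = *-nonNeg (0≤A j n) (0≤u n)

0≤F : ∀ j n → 0ℚ ≤ F j n
0≤F zero    n = 0≤Au zero n
0≤F (suc j) n = +-nonNeg (0≤F j n) (0≤Au (suc j) n)

Au≤F : ∀ j n → A j n * u n ≤ F j n
Au≤F zero    n = ≤-refl
Au≤F (suc j) n = subst (_≤ F (suc j) n) (+-identityˡ (A (suc j) n * u n))
  (+-monoˡ-≤ (A (suc j) n * u n) (0≤F j n))

F-diff : ∀ j n → F j n - F j (suc n) ≡ A j n * (u n * u (suc n))
F-diff zero n = trans
  (solve 2 (λ p q → con 1ℚ :* p :- con 1ℚ :* q := con 1ℚ :* (p :- q)) refl (u n) (u (suc n)))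
  (cong (1ℚ *_) (u-diff n))
F-diff (suc j) n = begin
  (f + a * p) - (f′ + (a + b * p) * q)
    ≡⟨ solve 6 (λ f f′ a b p q → (f :+ a :* p) :- (f′ :+ (a :+ b :* p) :* q)
         := (f :- f′) :+ (a :* (p :- q) :- b :* (p :* q))) refl f f′ a b p q ⟩
  (f - f′) + (a * (p - q) - b * (p * q))
    ≡⟨ cong₂ (λ s t → s + (a * t - b * (p * q))) (F-diff j n) (u-diff n) ⟩
  b * (p * q) + (a * (p * q) - b * (p * q))
    ≡⟨ solve 2 (λ x y → x :+ (y :- x) := y) refl (b * (p * q)) (a * (p * q)) ⟩
  a * (p * q) ∎
  where
  open ≡-Reasoning
  f = F j n
  f′ = F j (suc n)
  a = A (suc j) n
  b = A j n
  p = u n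
  q = u (suc n)

null-Au : ∀ j → Null (λ n → A j n * u n)
null-Au zero    = null-scale 1ℚ null-u
null-Au (suc j) = cesàro (A (suc j)) (λ n → A j n * u n) (0≤A (suc j)) (λ _ → refl) (null-Au j)

null-F : ∀ j → Null (F j)
null-F zero    = null-Au zero
null-F (suc j) = null-+ {F j} {λ n → A (suc j) n * u n} (null-F j) (null-Au (suc j))

sign : ℕ → ℚ
sign k = (-1ℤ ℤ.^ k) / 1

sign-suc : ∀ k → sign (suc k) ≡ - sign k
sign-suc k = trans (sym (/-*-/ -1ℤ (-1ℤ ℤ.^ k) 1 1))
  (trans (sym (neg-distribˡ-* 1ℚ (sign k))) (cong -_ (*-identityˡ (sign k))))

∣sign∣ : ∀ k → ∣ sign k ∣ ≡ 1ℚ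
∣sign∣ zero    = refl
∣sign∣ (suc k) = trans (cong ∣_∣ (sign-suc k)) (trans (∣-p∣≡∣p∣ (sign k)) (∣sign∣ k))

pow : ℕ → ℕ → ℚ
pow s n = (+ 1 / (suc n ℕ.^ s)) {{m^n≢0 (suc n) s}}

pow-suc : ∀ s n → pow (suc s) n ≡ u n * pow s n
pow-suc s n = sym (/-*-/ (+ 1) (+ 1) (suc n) (suc n ℕ.^ s)
  {{_}} {{m^n≢0 (suc n) s}} {{m^n≢0 (suc n) (suc s)}})

0≤pow : ∀ s n → 0ℚ ≤ pow s n
0≤pow zero    n = <⇒≤ 0<1
0≤pow (suc s) n = subst (0ℚ ≤_) (sym (pow-suc s n)) (*-nonNeg (0≤u n) (0≤pow s n))

pow≤1 : ∀ s n → pow s n ≤ 1ℚ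
pow≤1 zero    n = ≤-refl
pow≤1 (suc s) n = subst (_≤ 1ℚ) (sym (pow-suc s n))
  (*-mono (0≤pow s n) (<⇒≤ 0<1) (u≤1 n) (pow≤1 s n))

pow≤u : ∀ s n → pow (suc s) n ≤ u n
pow≤u s n = subst₂ _≤_ (sym (pow-suc s n)) (*-identityʳ (u n))
  (*-mono (0≤pow s n) (0≤u n) ≤-refl (pow≤1 s n))

pow≤u² : ∀ s n → pow (suc (suc s)) n ≤ u n * u n
pow≤u² s n = subst (_≤ u n * u n) (sym (pow-suc (suc s) n))
  (*-mono (0≤pow (suc s) n) (0≤u n) ≤-refl (pow≤u s n))

factor-bar : ∀ s .{{_ : NonZero s}} n → factor (bar s) (suc n) ≡ sign (suc n) * pow s n
factor-bar s n = sym (trans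
  (/-*-/ (-1ℤ ℤ.^ suc n) (+ 1) 1 (suc n ℕ.^ s) {{_}} {{m^n≢0 (suc n) s}} {{nz}})
  (/-cong {{nz}} {{m^n≢0 (suc n) s}} (ℤ.*-identityʳ (-1ℤ ℤ.^ suc n)) (ℕ.*-identityˡ (suc n ℕ.^ s))))
  where
  nz : NonZero (1 ℕ.* suc n ℕ.^ s)
  nz = ℕ.m*n≢0 1 (suc n ℕ.^ s) {{_}} {{m^n≢0 (suc n) s}}

∣factor-plain∣ : ∀ s .{{_ : NonZero s}} n → ∣ factor (plain s) (suc n) ∣ ≡ pow s n
∣factor-plain∣ s n = 0≤p⇒∣p∣≡p (0≤pow s n)

∣factor-bar∣ : ∀ s .{{_ : NonZero s}} n → ∣ factor (bar s) (suc n) ∣ ≡ pow s n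
∣factor-bar∣ s n = trans (cong ∣_∣ (factor-bar s n))
  (trans (∣p*q∣≡∣p∣*∣q∣ (sign (suc n)) (pow s n))
    (trans (cong₂ _*_ (∣sign∣ (suc n)) (0≤p⇒∣p∣≡p (0≤pow s n))) (*-identityˡ (pow s n))))

∣factor∣≤u : ∀ e n → ∣ factor e (suc n) ∣ ≤ u n
∣factor∣≤u (plain (suc s)) n = subst (_≤ u n) (sym (∣factor-plain∣ (suc s) n)) (pow≤u s n)
∣factor∣≤u (bar   (suc s)) n = subst (_≤ u n) (sym (∣factor-bar∣ (suc s) n)) (pow≤u s n)

∣zetaSum∣≤A : ∀ es n → ∣ zetaSum es n ∣ ≤ A (length es) n
∣zetaSum∣≤A []       n       = ≤-refl
∣zetaSum∣≤A (e ∷ es) zero    = ≤-refl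
∣zetaSum∣≤A (e ∷ es) (suc n) = begin
  ∣ z + f * y ∣          ≤⟨ ∣p+q∣≤∣p∣+∣q∣ z (f * y) ⟩
  ∣ z ∣ + ∣ f * y ∣      ≡⟨ cong (_+_ ∣ z ∣) (trans (∣p*q∣≡∣p∣*∣q∣ f y) (*-comm ∣ f ∣ ∣ y ∣)) ⟩
  ∣ z ∣ + ∣ y ∣ * ∣ f ∣  ≤⟨ +-mono-≤ (∣zetaSum∣≤A (e ∷ es) n)
                              (*-mono (0≤∣p∣ f) (0≤A (length es) n) (∣zetaSum∣≤A es n) (∣factor∣≤u e n)) ⟩
  A (suc (length es)) n + A (length es) n * u n ∎
  where
  open ≤-Reasoning
  z = zetaSum (e ∷ es) n
  f = factor e (suc n)
  y = zetaSum es n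

zetaSum-step : ∀ e es n →
  zetaSum (e ∷ es) (suc n) - zetaSum (e ∷ es) n ≡ factor e (suc n) * zetaSum es n
zetaSum-step e es n = solve 2 (λ x y → (x :+ y) :- x := y) refl
  (zetaSum (e ∷ es) n) (factor e (suc n) * zetaSum es n)

∣zetaSum-step∣≤ : ∀ e es n →
  ∣ zetaSum (e ∷ es) (suc n) - zetaSum (e ∷ es) n ∣ ≤ A (length es) n * u n
∣zetaSum-step∣≤ e es n = begin
  ∣ zetaSum (e ∷ es) (suc n) - zetaSum (e ∷ es) n ∣  ≡⟨ cong ∣_∣ (zetaSum-step e es n) ⟩
  ∣ f * y ∣        ≡⟨ trans (∣p*q∣≡∣p∣*∣q∣ f y) (*-comm ∣ f ∣ ∣ y ∣) ⟩
  ∣ y ∣ * ∣ f ∣    ≤⟨ *-mono (0≤∣p∣ f) (0≤A (length es) n) (∣zetaSum∣≤A es n) (∣factor∣≤u e n) ⟩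
  A (length es) n * u n ∎
  where
  open ≤-Reasoning
  f = factor e (suc n)
  y = zetaSum es n

∣zetaSum-step∣≤′ : ∀ es n →
  ∣ zetaSum es (suc n) - zetaSum es n ∣ ≤ A (ℕ.pred (length es)) n * u n
∣zetaSum-step∣≤′ []       n = 0≤Au zero n
∣zetaSum-step∣≤′ (e ∷ es) n = ∣zetaSum-step∣≤ e es n

cauchy-absolute : ∀ e es → (∀ n → ∣ factor e (suc n) ∣ ≤ u n * u n) →
  Cauchy (zetaSum (e ∷ es))
cauchy-absolute e es ∣f∣≤ = telescope⇒cauchy {zetaSum (e ∷ es)} {λ n → F r n + F r n}
  (λ n → +-nonNeg (0≤F r n) (0≤F r n))
  (null-+ {F r} {F r} (null-F r) (null-F r))
  step
  where
  open ≤-Reasoning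
  r = length es
  step : ∀ n → ∣ zetaSum (e ∷ es) (suc n) - zetaSum (e ∷ es) n ∣
    ≤ (F r n + F r n) - (F r (suc n) + F r (suc n))
  step n = begin
    ∣ zetaSum (e ∷ es) (suc n) - zetaSum (e ∷ es) n ∣  ≡⟨ cong ∣_∣ (zetaSum-step e es n) ⟩
    ∣ f * y ∣              ≡⟨ trans (∣p*q∣≡∣p∣*∣q∣ f y) (*-comm ∣ f ∣ ∣ y ∣) ⟩
    ∣ y ∣ * ∣ f ∣          ≤⟨ *-mono (0≤∣p∣ f) (0≤A r n) (∣zetaSum∣≤A es n) (∣f∣≤ n) ⟩
    a * (p * p)            ≤⟨ *-monoˡ-≤-nonNeg a {{ℚ.nonNegative (0≤A r n)}}
                                (*-monoˡ-≤-nonNeg p {{ℚ.nonNegative (0≤u n)}} (u≤2u-suc n)) ⟩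
    a * (p * (q + q))      ≡⟨ solve 3 (λ a p q → a :* (p :* (q :+ q)) := a :* (p :* q) :+ a :* (p :* q)) refl a p q ⟩
    a * (p * q) + a * (p * q)
      ≡⟨ cong₂ _+_ (sym (F-diff r n)) (sym (F-diff r n)) ⟩
    (F r n - F r (suc n)) + (F r n - F r (suc n))
      ≡⟨ solve 2 (λ x y → (x :- y) :+ (x :- y) := (x :+ x) :- (y :+ y)) refl (F r n) (F r (suc n)) ⟩
    (F r n + F r n) - (F r (suc n) + F r (suc n)) ∎
    where
    f = factor e (suc n)
    y = zetaSum es n
    a = A r n
    p = u n
    q = u (suc n)

-- Conditional convergence: consecutive terms nearly cancel, so the sums
-- t n = z n + z (suc n) converge absolutely.
cauchy-bar1 : ∀ es → Cauchy (zetaSum (bar 1 ∷ es))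
cauchy-bar1 es = bounded⇒cauchy {z} {G} null-G bound
  where
  open ≤-Reasoning
  z t f G : ℕ → ℚ
  r r′ : ℕ
  z = zetaSum (bar 1 ∷ es)
  t n = z n + z (suc n)
  r = length es
  r′ = ℕ.pred r
  f n = F r n + F r′ n
  G n = f n + (f n + f n)

  0≤f : ∀ n → 0ℚ ≤ f n
  0≤f n = +-nonNeg (0≤F r n) (0≤F r′ n)

  null-f : Null f
  null-f = null-+ {F r} {F r′} (null-F r) (null-F r′)

  null-G : Null G
  null-G = null-+ {f} {λ n → f n + f n} null-f (null-+ {f} {f} null-f null-f)

  z-step : ∀ n → z (suc n) - z n ≡ (sign (suc n) * u n) * zetaSum es n
  z-step n = trans (zetaSum-step (bar 1) es n)
    (cong (_* zetaSum es n)
      (trans (factor-bar 1 n) (cong (sign (suc n) *_) (trans (pow-suc 0 n) (*-identityʳ (u n))))))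

  t-step : ∀ n → ∣ t (suc n) - t n ∣ ≤ f n - f (suc n)
  t-step n = begin
    ∣ (z (suc n) + z (suc (suc n))) - (z n + z (suc n)) ∣
      ≡⟨ cong ∣_∣ (solve 3 (λ x y w → (y :+ w) :- (x :+ y) := (w :- y) :+ (y :- x)) refl (z n) (z (suc n)) (z (suc (suc n)))) ⟩
    ∣ (z (suc (suc n)) - z (suc n)) + (z (suc n) - z n) ∣
      ≡⟨ cong ∣_∣ (cong₂ _+_ (z-step (suc n)) (z-step n)) ⟩
    ∣ (sign (suc (suc n)) * q) * y′ + (s * p) * y ∣
      ≡⟨ cong (λ x → ∣ (x * q) * y′ + (s * p) * y ∣) (sign-suc (suc n)) ⟩
    ∣ (- s * q) * y′ + (s * p) * y ∣
      ≡⟨ cong ∣_∣ (solve 5 (λ s p q y y′ → ((:- s) :* q) :* y′ :+ (s :* p) :* y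
           := s :* (y :* (p :- q) :- (y′ :- y) :* q)) refl s p q y y′) ⟩
    ∣ s * (y * (p - q) - (y′ - y) * q) ∣
      ≡⟨ trans (∣p*q∣≡∣p∣*∣q∣ s (y * (p - q) - (y′ - y) * q))
           (trans (cong (_* ∣ y * (p - q) - (y′ - y) * q ∣) (∣sign∣ (suc n)))
                  (*-identityˡ ∣ y * (p - q) - (y′ - y) * q ∣)) ⟩
    ∣ y * (p - q) - (y′ - y) * q ∣
      ≤⟨ ∣p-q∣≤∣p∣+∣q∣ (y * (p - q)) ((y′ - y) * q) ⟩
    ∣ y * (p - q) ∣ + ∣ (y′ - y) * q ∣
      ≡⟨ cong₂ _+_ (trans (cong (λ x → ∣ y * x ∣) (u-diff n)) (∣p*q∣≡∣p∣*∣q∣ y (p * q)))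
                   (∣p*q∣≡∣p∣*∣q∣ (y′ - y) q) ⟩
    ∣ y ∣ * ∣ p * q ∣ + ∣ y′ - y ∣ * ∣ q ∣
      ≡⟨ cong₂ (λ v w → ∣ y ∣ * v + ∣ y′ - y ∣ * w)
           (0≤p⇒∣p∣≡p (*-nonNeg (0≤u n) (0≤u (suc n)))) (0≤p⇒∣p∣≡p (0≤u (suc n))) ⟩
    ∣ y ∣ * (p * q) + ∣ y′ - y ∣ * q
      ≤⟨ +-mono-≤
           (*-monoʳ-≤-nonNeg (p * q) {{ℚ.nonNegative (*-nonNeg (0≤u n) (0≤u (suc n)))}} (∣zetaSum∣≤A es n))
           (*-monoʳ-≤-nonNeg q {{ℚ.nonNegative (0≤u (suc n))}} (∣zetaSum-step∣≤′ es n)) ⟩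
    A r n * (p * q) + (A r′ n * p) * q
      ≡⟨ cong (_+_ (A r n * (p * q))) (*-assoc (A r′ n) p q) ⟩
    A r n * (p * q) + A r′ n * (p * q)
      ≡⟨ cong₂ _+_ (sym (F-diff r n)) (sym (F-diff r′ n)) ⟩
    (F r n - F r (suc n)) + (F r′ n - F r′ (suc n))
      ≡⟨ solve 4 (λ a b c d → (a :- b) :+ (c :- d) := (a :+ c) :- (b :+ d)) refl
           (F r n) (F r (suc n)) (F r′ n) (F r′ (suc n)) ⟩
    f n - f (suc n) ∎
    where
    s = sign (suc n)
    p = u n
    q = u (suc n)
    y = zetaSum es n
    y′ = zetaSum es (suc n)

  ∣t∣≤ : ∀ n d → ∣ t (d ℕ.+ n) - t n ∣ ≤ f n - f (d ℕ.+ n)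
  ∣t∣≤ = telescope {t} {f} t-step

  f-antitone : ∀ n d → f (d ℕ.+ n) ≤ f n
  f-antitone n d = 0≤q-p⇒p≤q (≤-trans (0≤∣p∣ (t (d ℕ.+ n) - t n)) (∣t∣≤ n d))

  ∣dz∣≤ : ∀ n → ∣ z (suc n) - z n ∣ ≤ f n
  ∣dz∣≤ n = ≤-trans (∣zetaSum-step∣≤ (bar 1) es n)
    (≤-trans (Au≤F r n) (p≤p+q (0≤F r′ n)))

  bound : ∀ n d → ∣ z (d ℕ.+ n) - z n ∣ ≤ G n
  bound n d = begin
    ∣ z m - z n ∣
      ≤⟨ p≤p+q (0≤∣p∣ (z m - z n)) ⟩
    ∣ z m - z n ∣ + ∣ z m - z n ∣
      ≡⟨ solve 1 (λ x → x :+ x := (con 1ℚ :+ con 1ℚ) :* x) refl ∣ z m - z n ∣ ⟩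
    ∣ 1ℚ + 1ℚ ∣ * ∣ z m - z n ∣
      ≡⟨ sym (∣p*q∣≡∣p∣*∣q∣ (1ℚ + 1ℚ) (z m - z n)) ⟩
    ∣ (1ℚ + 1ℚ) * (z m - z n) ∣
      ≡⟨ cong ∣_∣ (solve 4 (λ x x′ y y′ → (con 1ℚ :+ con 1ℚ) :* (x :- y)
           := ((x :+ x′) :- (y :+ y′)) :+ ((y′ :- y) :- (x′ :- x))) refl
           (z m) (z (suc m)) (z n) (z (suc n))) ⟩
    ∣ (t m - t n) + ((z (suc n) - z n) - (z (suc m) - z m)) ∣
      ≤⟨ ∣p+q∣≤∣p∣+∣q∣ (t m - t n) ((z (suc n) - z n) - (z (suc m) - z m)) ⟩
    ∣ t m - t n ∣ + ∣ (z (suc n) - z n) - (z (suc m) - z m) ∣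
      ≤⟨ +-mono-≤ (≤-trans (∣t∣≤ n d) (p-q≤p {f n} {f m} (0≤f m)))
           (≤-trans (∣p-q∣≤∣p∣+∣q∣ (z (suc n) - z n) (z (suc m) - z m))
             (+-mono-≤ (∣dz∣≤ n) (≤-trans (∣dz∣≤ m) (f-antitone n d)))) ⟩
    G n ∎
    where m = d ℕ.+ n

zetaSum-cauchy : ∀ es → Convergent es → Cauchy (zetaSum es)
zetaSum-cauchy []                        _ = cauchy-const 1ℚ
zetaSum-cauchy (plain (suc zero) ∷ es)   (ℕ.s≤s ())
zetaSum-cauchy (plain (suc (suc s)) ∷ es) _ = cauchy-absolute (plain (suc (suc s))) es
  (λ n → subst (_≤ u n * u n) (sym (∣factor-plain∣ (suc (suc s)) n)) (pow≤u² s n))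
zetaSum-cauchy (bar (suc zero) ∷ es)     _ = cauchy-bar1 es
zetaSum-cauchy (bar (suc (suc s)) ∷ es)  _ = cauchy-absolute (bar (suc (suc s))) es
  (λ n → subst (_≤ u n * u n) (sym (∣factor-bar∣ (suc (suc s)) n)) (pow≤u² s n))

ζ : (es : List Entry) {_ : Convergent es} → ℝ
ζ es {c} = lim (zetaSum es) (zetaSum-cauchy es c)

ones : ℕ → List Entry
ones r = replicate r (plain 1)

∑ℚ : ℕ → (ℕ → ℚ) → ℚ
∑ℚ zero    f = 0ℚ
∑ℚ (suc n) f = ∑ℚ n f + f (suc n)

-- The right Riemann sum of mesh h = 1 / (n + 1) for the integral of 1 / t
-- over [1, p]: the nodes are 1 + j h for 1 ≤ j ≤ (p - 1) (n + 1), and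
-- h · 1 / (1 + j h) = 1 / (n + 1 + j).
lnSum : ℕ → ℕ → ℚ
lnSum p n = ∑ℚ ((p ℕ.∸ 1) ℕ.* suc n) (λ j → + 1 / (suc n ℕ.+ j))

harmonic : ℕ → ℚ
harmonic zero    = 0ℚ
harmonic (suc n) = harmonic n + u n

harmonic-+ : ∀ k n →
  harmonic (k ℕ.+ suc n) ≡ harmonic (suc n) + ∑ℚ k (λ j → + 1 / (suc n ℕ.+ j))
harmonic-+ zero    n = sym (+-identityʳ (harmonic (suc n)))
harmonic-+ (suc k) n = trans
  (cong₂ _+_ (harmonic-+ k n) (cong u (trans (ℕ.+-comm k (suc n)) (sym (ℕ.+-suc n k)))))
  (+-assoc (harmonic (suc n)) (∑ℚ k (λ j → + 1 / (suc n ℕ.+ j))) (u (n ℕ.+ suc k)))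

lnSum-harmonic : ∀ p n →
  lnSum (suc p) n ≡ harmonic (suc p ℕ.* suc n) - harmonic (suc n)
lnSum-harmonic p n = trans
  (solve 2 (λ x y → y := (x :+ y) :- x) refl (harmonic (suc n)) (lnSum (suc p) n))
  (cong (_- harmonic (suc n))
    (trans (sym (harmonic-+ (p ℕ.* suc n) n)) (cong harmonic (ℕ.+-comm (p ℕ.* suc n) (suc n)))))

harmonic-block : ∀ k m c c′ → (∀ i → i ℕ.< k → c ≤ u (i ℕ.+ m)) →
  (∀ i → i ℕ.< k → u (i ℕ.+ m) ≤ c′) →
  (+ k / 1) * c ≤ harmonic (k ℕ.+ m) - harmonic m ×
  harmonic (k ℕ.+ m) - harmonic m ≤ (+ k / 1) * c′
harmonic-block zero m c c′ _ _ =
  ≤-reflexive (trans (*-zeroˡ c) (sym (+-inverseʳ (harmonic m)))) ,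
  ≤-reflexive (trans (+-inverseʳ (harmonic m)) (sym (*-zeroˡ c′)))
harmonic-block (suc k) m c c′ c≤ ≤c′ = lower , upper
  where
  open ≤-Reasoning
  h = harmonic (k ℕ.+ m)
  v = u (k ℕ.+ m)
  rec = harmonic-block k m c c′ (λ i lt → c≤ i (ℕ.m<n⇒m<1+n lt)) (λ i lt → ≤c′ i (ℕ.m<n⇒m<1+n lt))
  regroup : (h - harmonic m) + v ≡ (h + v) - harmonic m
  regroup = solve 3 (λ h h′ v → (h :- h′) :+ v := (h :+ v) :- h′) refl h (harmonic m) v
  expand : ∀ d → (+ suc k / 1) * d ≡ (+ k / 1) * d + d
  expand d = trans (cong (_* d) ([1+n]/1 k))
    (solve 2 (λ x d → (x :+ con 1ℚ) :* d := x :* d :+ d) refl (+ k / 1) d)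
  lower : (+ suc k / 1) * c ≤ (h + v) - harmonic m
  lower = begin
    (+ suc k / 1) * c       ≡⟨ expand c ⟩
    (+ k / 1) * c + c       ≤⟨ +-mono-≤ (proj₁ rec) (c≤ k (ℕ.n<1+n k)) ⟩
    (h - harmonic m) + v    ≡⟨ regroup ⟩
    (h + v) - harmonic m    ∎
  upper : (h + v) - harmonic m ≤ (+ suc k / 1) * c′
  upper = begin
    (h + v) - harmonic m    ≡⟨ sym regroup ⟩
    (h - harmonic m) + v    ≤⟨ +-mono-≤ (proj₂ rec) (≤c′ k (ℕ.n<1+n k)) ⟩
    (+ k / 1) * c′ + c′     ≡⟨ sym (expand c′) ⟩
    (+ suc k / 1) * c′      ∎

scaled-u : ∀ p n → (+ suc p / 1) * u (n ℕ.+ p ℕ.* suc n) ≡ u n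
scaled-u p n = begin
  (+ suc p / 1) * u (n ℕ.+ p ℕ.* suc n)  ≡⟨ cong ((+ suc p / 1) *_) (sym (/-*-/ (+ 1) (+ 1) (suc p) (suc n))) ⟩
  (+ suc p / 1) * (u p * u n)            ≡⟨ sym (*-assoc (+ suc p / 1) (u p) (u n)) ⟩
  (+ suc p / 1) * u p * u n              ≡⟨ cong (_* u n) ([1+n]*u p) ⟩
  1ℚ * u n                               ≡⟨ *-identityˡ (u n) ⟩
  u n                                    ∎
  where open ≡-Reasoning

lnSum-cauchy : ∀ p .{{_ : NonZero p}} → Cauchy (lnSum p)
lnSum-cauchy (suc p) = telescope⇒cauchy {lnSum (suc p)} {u} 0≤u null-u step
  where
  h : ℕ → ℚ
  h n = harmonic (suc p ℕ.* suc n)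

  block : ∀ n → u (suc n) ≤ h (suc n) - h n × h (suc n) - h n ≤ u n
  block n = subst (λ k → u (suc n) ≤ harmonic k - h n × harmonic k - h n ≤ u n)
    (sym (ℕ.*-suc (suc p) (suc n)))
    (subst (_≤ d) (scaled-u p (suc n)) (proj₁ bounds) ,
     subst (d ≤_) (scaled-u p n) (proj₂ bounds))
    where
    m = suc p ℕ.* suc n
    d = harmonic (suc p ℕ.+ m) - harmonic m
    bounds = harmonic-block (suc p) m
      (u (suc n ℕ.+ p ℕ.* suc (suc n))) (u (n ℕ.+ p ℕ.* suc n))
      (λ i i≤p → u-antitone (ℕ.≤-pred (subst (suc (i ℕ.+ m) ℕ.≤_)
        (sym (ℕ.*-suc (suc p) (suc n))) (ℕ.+-monoˡ-≤ m i≤p))))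
      (λ i _ → u-antitone (ℕ.≤-trans (ℕ.n≤1+n _) (ℕ.m≤n+m m i)))

  step : ∀ n → ∣ lnSum (suc p) (suc n) - lnSum (suc p) n ∣ ≤ u n - u (suc n)
  step n = begin
    ∣ lnSum (suc p) (suc n) - lnSum (suc p) n ∣
      ≡⟨ cong ∣_∣ (cong₂ _-_ (lnSum-harmonic p (suc n)) (lnSum-harmonic p n)) ⟩
    ∣ (h (suc n) - (g + u (suc n))) - (h n - g) ∣
      ≡⟨ cong ∣_∣ (solve 4 (λ a b g v → (a :- (g :+ v)) :- (b :- g) := (a :- b) :- v) refl (h (suc n)) (h n) g (u (suc n))) ⟩
    ∣ (h (suc n) - h n) - u (suc n) ∣
      ≡⟨ 0≤p⇒∣p∣≡p (p≤q⇒0≤q-p (proj₁ (block n))) ⟩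
    (h (suc n) - h n) - u (suc n)
      ≤⟨ +-monoˡ-≤ (- u (suc n)) (proj₂ (block n)) ⟩
    u n - u (suc n) ∎
    where
    open ≤-Reasoning
    g = harmonic (suc n)

-- ln p is the integral of 1 / t over [1, p].
ln : (p : ℕ) .{{_ : NonZero p}} → ℝ
ln p = lim (lnSum p) (lnSum-cauchy p)

{-# OPTIONS --safe #-}
module Submission where

open import Data.List.Base using (List; []; _∷_; _++_; length)
open import Data.Nat.Base using (ℕ; NonZero; _∸_)
open import Data.Rational.Base using (1ℚ; ½)
open import Defs using (_≃ℝ_; _+ℝ_; _-ℝ_; -ℝ_; _*ℝ_; _^ℝ_; 1/_!; ∑ℝ; fromℚ; plain; bar; ζ; ones; ln)

open import Data.Integer.Base using (+_)
open import Data.Nat.Base as ℕ using (zero; suc; _!)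
import Data.Nat.Properties as ℕ
open import Data.Product.Base using (∃; _×_; _,_)
open import Data.Rational.Base as ℚ
  using (ℚ; 0ℚ; _/_; _+_; _*_; _-_; -_; ∣_∣; _≤_; _<_)
open import Data.Rational.Properties
import Data.Rational.Solver
open import Defs hiding (_≃ℝ_; _+ℝ_; _-ℝ_; -ℝ_; _*ℝ_; _^ℝ_; 1/_!; ∑ℝ; fromℚ; plain; bar; ζ; ones; ln)
open import Function.Base using (_∘_)
open import Relation.Binary.PropositionalEquality
  using (_≡_; refl; sym; trans; cong; cong₂; subst; module ≡-Reasoning)

open Data.Rational.Solver.+-*-Solver
  using (solve; _:=_; _:+_; _:*_; _:-_; :-_; con)

-- Let L(s₁, …, sᵣ) be the power series ∑ x^k₁ / (k₁^s₁ ⋯ kᵣ^sᵣ) over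
-- k₁ > ⋯ > kᵣ ≥ 1, and θ = x d/dx. Then θ L(1, w) = x / (1 - x) · L(w) and
-- θ L(s + 1, w) = L(s, w), so that θ applied to
--   ∑ᵢ₌₀ᵏ (-1)ⁱ L({1}ᵢ) L({1}ₖ₋ᵢ, 3, {1}ₖ₋₁)
-- telescopes to (-1)ᵏ L({1}ₖ) L(2, {1}ₖ₋₁), the θ-derivative of
-- (-1)ᵏ / 2 · L(2, {1}ₖ₋₁)². This gives an identity of power series. At
-- x = -1 Cauchy products converge to the products of the values, because
-- coefficients and alternating tails are O(logʳ n / n), and
-- (-1)ⁱ L({1}ᵢ)(-1) = (ln 2)ⁱ / i! since L(1) L({1}ᵢ) = (i + 1) L({1}ᵢ₊₁).

-- The bar sits on `k₁` alone, so every ζ-value of the theorem is a series in `x^k₁` taken at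
-- `x = -1`, and one variable suffices. The two blocks of ones have equal length because `θ` lowers
-- `L(2, {1}ₖ₋₁)` to `L({1}ₖ)`: only so is the last product half the derivative of a square. The
-- obstacle is the passage to values. For `i ≥ 1` the series `L({1}ᵢ)` converges only conditionally
-- at -1, and so do the series with first exponent 1 that multiply it; Mertens' theorem does not
-- cover such products, hence the explicit logarithmic rates. The identity itself is exact for the
-- rational partial sums at every `n`; limits enter only when products of series are replaced by
-- products of values.

Series : Set
Series = ℕ → ℚ

-- Formal power series: Cauchy product, `∑<` and the derivation `θ`.

infixl 7 _⊛_

-- Recursion by shifting the left factor avoids sums with indices `n ∸ i`; the laws become
-- inductions in which `a` varies.
_⊛_ : Series → Series → Series
(a ⊛ b) zero    = a 0 * b 0
(a ⊛ b) (suc n) = a 0 * b (suc n) + ((a ∘ suc) ⊛ b) n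

-- As an operation on power series, ∑< is multiplication by x / (1 - x).
∑< : Series → Series
∑< a zero    = 0ℚ
∑< a (suc n) = ∑< a n + a n

θ : Series → Series
θ a n = (+ n / 1) * a n

⊛-cong : ∀ {a a′ b b′ : Series} → (∀ n → a n ≡ a′ n) → (∀ n → b n ≡ b′ n) →
  ∀ n → (a ⊛ b) n ≡ (a′ ⊛ b′) n
⊛-cong p q zero    = cong₂ _*_ (p 0) (q 0)
⊛-cong p q (suc n) = cong₂ _+_ (cong₂ _*_ (p 0) (q (suc n))) (⊛-cong (p ∘ suc) q n)

⊛-distribʳ : ∀ a a′ b n → ((λ m → a m + a′ m) ⊛ b) n ≡ (a ⊛ b) n + (a′ ⊛ b) n
⊛-distribʳ a a′ b zero    = *-distribʳ-+ (b 0) (a 0) (a′ 0)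
⊛-distribʳ a a′ b (suc n) = trans
  (cong (_+_ ((a 0 + a′ 0) * b (suc n))) (⊛-distribʳ (a ∘ suc) (a′ ∘ suc) b n))
  (solve 5 (λ x x′ y v w → (x :+ x′) :* y :+ (v :+ w) := (x :* y :+ v) :+ (x′ :* y :+ w)) refl
    (a 0) (a′ 0) (b (suc n)) (((a ∘ suc) ⊛ b) n) (((a′ ∘ suc) ⊛ b) n))

⊛-scaleˡ : ∀ c a b n → ((λ m → c * a m) ⊛ b) n ≡ c * (a ⊛ b) n
⊛-scaleˡ c a b zero    = *-assoc c (a 0) (b 0)
⊛-scaleˡ c a b (suc n) = trans
  (cong (_+_ (c * a 0 * b (suc n))) (⊛-scaleˡ c (a ∘ suc) b n))
  (solve 4 (λ c x y v → c :* x :* y :+ c :* v := c :* (x :* y :+ v)) refl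
    c (a 0) (b (suc n)) (((a ∘ suc) ⊛ b) n))

-- Peeling off the other end of the convolution repairs the asymmetry of the recursion;
-- commutativity follows, and with it the right-hand version of each left-hand law.
⊛-unfoldʳ : ∀ a b n → (a ⊛ b) (suc n) ≡ (a ⊛ (b ∘ suc)) n + a (suc n) * b 0
⊛-unfoldʳ a b zero    = refl
⊛-unfoldʳ a b (suc n) = trans
  (cong (_+_ (a 0 * b (suc (suc n)))) (⊛-unfoldʳ (a ∘ suc) b n))
  (sym (+-assoc (a 0 * b (suc (suc n))) (((a ∘ suc) ⊛ (b ∘ suc)) n) (a (suc (suc n)) * b 0)))

⊛-comm : ∀ a b n → (a ⊛ b) n ≡ (b ⊛ a) n
⊛-comm a b zero    = *-comm (a 0) (b 0)
⊛-comm a b (suc n) = begin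
  a 0 * b (suc n) + ((a ∘ suc) ⊛ b) n   ≡⟨ cong₂ _+_ (*-comm (a 0) (b (suc n))) (⊛-comm (a ∘ suc) b n) ⟩
  b (suc n) * a 0 + (b ⊛ (a ∘ suc)) n   ≡⟨ +-comm (b (suc n) * a 0) ((b ⊛ (a ∘ suc)) n) ⟩
  (b ⊛ (a ∘ suc)) n + b (suc n) * a 0   ≡⟨ sym (⊛-unfoldʳ b a n) ⟩
  (b ⊛ a) (suc n)                       ∎
  where open ≡-Reasoning

⊛-distribˡ : ∀ a b b′ n → (a ⊛ (λ m → b m + b′ m)) n ≡ (a ⊛ b) n + (a ⊛ b′) n
⊛-distribˡ a b b′ n = trans (⊛-comm a (λ m → b m + b′ m) n)
  (trans (⊛-distribʳ b b′ a n) (cong₂ _+_ (⊛-comm b a n) (⊛-comm b′ a n)))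

⊛-scaleʳ : ∀ c a b n → (a ⊛ (λ m → c * b m)) n ≡ c * (a ⊛ b) n
⊛-scaleʳ c a b n = trans (⊛-comm a (λ m → c * b m) n)
  (trans (⊛-scaleˡ c b a n) (cong (c *_) (⊛-comm b a n)))

⊛-constʳ : ∀ a c n → (a ⊛ (λ _ → c)) n ≡ ∑< a (suc n) * c
⊛-constʳ a c zero    = cong (_* c) (sym (+-identityˡ (a 0)))
⊛-constʳ a c (suc n) = trans (⊛-unfoldʳ a (λ _ → c) n)
  (trans (cong (_+ a (suc n) * c) (⊛-constʳ a c n))
         (sym (*-distribʳ-+ c (∑< a (suc n)) (a (suc n)))))

-- `∑< a` starts with 0 and its shift is `∑< a + a`, so unfolding the product reproduces the
-- recursion of `∑<`.
∑<-⊛ˡ : ∀ a b n → (∑< a ⊛ b) n ≡ ∑< (a ⊛ b) n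
∑<-⊛ˡ a b zero    = *-zeroˡ (b 0)
∑<-⊛ˡ a b (suc n) = begin
  0ℚ * b (suc n) + ((λ m → ∑< a m + a m) ⊛ b) n
    ≡⟨ cong₂ _+_ (*-zeroˡ (b (suc n))) (⊛-distribʳ (∑< a) a b n) ⟩
  0ℚ + ((∑< a ⊛ b) n + (a ⊛ b) n)
    ≡⟨ +-identityˡ ((∑< a ⊛ b) n + (a ⊛ b) n) ⟩
  (∑< a ⊛ b) n + (a ⊛ b) n
    ≡⟨ cong (_+ (a ⊛ b) n) (∑<-⊛ˡ a b n) ⟩
  ∑< (a ⊛ b) n + (a ⊛ b) n ∎
  where open ≡-Reasoning

∑<-cong : ∀ {a b : Series} → (∀ n → a n ≡ b n) → ∀ n → ∑< a n ≡ ∑< b n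
∑<-cong p zero    = refl
∑<-cong p (suc n) = cong₂ _+_ (∑<-cong p n) (p n)

∑<-⊛ʳ : ∀ a b n → (a ⊛ ∑< b) n ≡ ∑< (a ⊛ b) n
∑<-⊛ʳ a b n = trans (⊛-comm a (∑< b) n) (trans (∑<-⊛ˡ b a n) (∑<-cong (⊛-comm b a) n))

θ-⊛ : ∀ a b n → θ (a ⊛ b) n ≡ (θ a ⊛ b) n + (a ⊛ θ b) n
θ-⊛ a b zero    = solve 2 (λ x y → con 0ℚ :* (x :* y) := con 0ℚ :* x :* y :+ x :* (con 0ℚ :* y)) refl (a 0) (b 0)
θ-⊛ a b (suc n) = begin
  N′ * (x * y + c)
    ≡⟨ cong (_* (x * y + c)) ([1+n]/1 n) ⟩
  (N + 1ℚ) * (x * y + c)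
    ≡⟨ solve 4 (λ N x y c → (N :+ con 1ℚ) :* (x :* y :+ c)
         := (N :+ con 1ℚ) :* (x :* y) :+ (N :* c :+ c)) refl N x y c ⟩
  (N + 1ℚ) * (x * y) + (N * c + c)
    ≡⟨ cong (λ t → (N + 1ℚ) * (x * y) + (t + c)) (θ-⊛ (a ∘ suc) b n) ⟩
  (N + 1ℚ) * (x * y) + ((d + e) + c)
    ≡⟨ solve 6 (λ N x y d e c → (N :+ con 1ℚ) :* (x :* y) :+ ((d :+ e) :+ c)
         := (con 0ℚ :* x :* y :+ (d :+ c)) :+ (x :* ((N :+ con 1ℚ) :* y) :+ e)) refl N x y d e c ⟩
  (0ℚ * x * y + (d + c)) + (x * ((N + 1ℚ) * y) + e)
    ≡⟨ cong₂ (λ s t → (0ℚ * x * y + s) + (x * (t * y) + e)) (sym shift) (sym ([1+n]/1 n)) ⟩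
  (θ a ⊛ b) (suc n) + (a ⊛ θ b) (suc n) ∎
  where
  open ≡-Reasoning
  N = + n / 1
  N′ = + suc n / 1
  x = a 0
  y = b (suc n)
  c = ((a ∘ suc) ⊛ b) n
  d = (θ (a ∘ suc) ⊛ b) n
  e = ((a ∘ suc) ⊛ θ b) n
  -- Shifting `θ a` raises each weight by one, which yields the extra summand `c`.
  shift : ((θ a ∘ suc) ⊛ b) n ≡ d + c
  shift = trans
    (⊛-cong {b = b} (λ m → trans (cong (_* a (suc m)) ([1+n]/1 m))
      (solve 2 (λ M x → (M :+ con 1ℚ) :* x := M :* x :+ x) refl (+ m / 1) (a (suc m)))) (λ _ → refl) n)
    (⊛-distribʳ (θ (a ∘ suc)) (a ∘ suc) b n)

u*[1+n]* : ∀ n x → u n * ((+ suc n / 1) * x) ≡ x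
u*[1+n]* n x = trans
  (solve 3 (λ v N x → v :* (N :* x) := (N :* v) :* x) refl (u n) (+ suc n / 1) x)
  (trans (cong (_* x) ([1+n]*u n)) (*-identityˡ x))

-- `θ` forgets only the constant coefficient; all others are recovered on dividing by the index.
θ-injective : ∀ {a b : Series} → a 0 ≡ b 0 → (∀ n → θ a n ≡ θ b n) → ∀ n → a n ≡ b n
θ-injective           p q zero    = p
θ-injective {a} {b} p q (suc n) =
  trans (sym (u*[1+n]* n (a (suc n)))) (trans (cong (u n *_) (q (suc n))) (u*[1+n]* n (b (suc n))))

-- The series of multiple harmonic sums and their derivatives.

-- coeff (plain s₁ ∷ ⋯ ∷ plain sᵣ ∷ []) is the series L(s₁, …, sᵣ).
coeff : List Entry → Series
coeff []       zero    = 1ℚ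
coeff []       (suc n) = 0ℚ
coeff (e ∷ es) zero    = 0ℚ
coeff (e ∷ es) (suc n) = factor e (suc n) * zetaSum es n

-- The argument is `suc n` because `∑<` is strict, whereas `zetaSum` includes `k₁ = n`.
zetaSum-coeff : ∀ es n → zetaSum es n ≡ ∑< (coeff es) (suc n)
zetaSum-coeff []       zero    = refl
zetaSum-coeff []       (suc n) = trans (zetaSum-coeff [] n) (sym (+-identityʳ (∑< (coeff []) (suc n))))
zetaSum-coeff (e ∷ es) zero    = refl
zetaSum-coeff (e ∷ es) (suc n) = cong (_+ factor e (suc n) * zetaSum es n) (zetaSum-coeff (e ∷ es) n)

0⊛ : ∀ b n → ((λ _ → 0ℚ) ⊛ b) n ≡ 0ℚ
0⊛ b zero    = *-zeroˡ (b 0)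
0⊛ b (suc n) = cong₂ _+_ (*-zeroˡ (b (suc n))) (0⊛ b n)

⊛-identityˡ : ∀ b n → (coeff [] ⊛ b) n ≡ b n
⊛-identityˡ b zero    = *-identityˡ (b 0)
⊛-identityˡ b (suc n) = trans (cong₂ _+_ (*-identityˡ (b (suc n))) (0⊛ b n)) (+-identityʳ (b (suc n)))

θ-coeff : ∀ s .{{_ : NonZero s}} es n → θ (coeff (plain (suc s) ∷ es)) n ≡ coeff (plain s ∷ es) n
θ-coeff s es zero    = refl
θ-coeff s es (suc n) = begin
  N * (pow (suc s) n * y)      ≡⟨ cong (λ t → N * (t * y)) (pow-suc s n) ⟩
  N * (u n * pow s n * y)      ≡⟨ solve 4 (λ N v p y → N :* (v :* p :* y) := v :* (N :* (p :* y))) refl N (u n) (pow s n) y ⟩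
  u n * (N * (pow s n * y))    ≡⟨ u*[1+n]* n (pow s n * y) ⟩
  pow s n * y                  ∎
  where
  open ≡-Reasoning
  N = + suc n / 1
  y = zetaSum es n

θ-coeff-1 : ∀ es n → θ (coeff (plain 1 ∷ es)) n ≡ ∑< (coeff es) n
θ-coeff-1 es zero    = refl
θ-coeff-1 es (suc n) = begin
  N * (pow 1 n * y)    ≡⟨ cong (λ t → N * (t * y)) (trans (pow-suc 0 n) (*-identityʳ (u n))) ⟩
  N * (u n * y)        ≡⟨ solve 3 (λ N v y → N :* (v :* y) := v :* (N :* y)) refl N (u n) y ⟩
  u n * (N * y)        ≡⟨ u*[1+n]* n y ⟩
  y                    ≡⟨ zetaSum-coeff es n ⟩
  ∑< (coeff es) (suc n) ∎
  where
  open ≡-Reasoning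
  N = + suc n / 1
  y = zetaSum es n

-- Both factors begin with 1, so `θ` strips a 1 from either one and leaves the same operator `∑<` in
-- front. All telescoping rests on this symmetry.
θ-ones-⊛ : ∀ i es n → θ (coeff (ones (suc i)) ⊛ coeff (plain 1 ∷ es)) n ≡
  ∑< (coeff (ones i) ⊛ coeff (plain 1 ∷ es)) n + ∑< (coeff (ones (suc i)) ⊛ coeff es) n
θ-ones-⊛ i es n = trans (θ-⊛ (coeff (ones (suc i))) (coeff (plain 1 ∷ es)) n)
  (cong₂ _+_
    (trans (⊛-cong {b = coeff (plain 1 ∷ es)} (θ-coeff-1 (ones i)) (λ _ → refl) n)
           (∑<-⊛ˡ (coeff (ones i)) (coeff (plain 1 ∷ es)) n))
    (trans (⊛-cong {a = coeff (ones (suc i))} (λ _ → refl) (θ-coeff-1 es) n)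
           (∑<-⊛ʳ (coeff (ones (suc i))) (coeff es) n)))

∑<-scale : ∀ c a n → ∑< (λ m → c * a m) n ≡ c * ∑< a n
∑<-scale c a zero    = sym (*-zeroʳ c)
∑<-scale c a (suc n) = trans (cong (_+ c * a n) (∑<-scale c a n)) (sym (*-distribˡ-+ c (∑< a n) (a n)))

-- A shuffle product: a further 1 fits into `suc i` places. Equivalently, `L({1}ᵢ)` is the `i`-th
-- power of `-log(1 - x)` divided by `i!`.
1⊛ones : ∀ i n → (coeff (ones 1) ⊛ coeff (ones i)) n ≡ (+ suc i / 1) * coeff (ones (suc i)) n
1⊛ones zero    n = trans (⊛-comm (coeff (ones 1)) (coeff []) n)
  (trans (⊛-identityˡ (coeff (ones 1)) n) (sym (*-identityˡ (coeff (ones 1) n))))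
1⊛ones (suc i) = θ-injective (sym (*-zeroʳ (+ suc (suc i) / 1))) λ n → begin
  θ (a 1 ⊛ a (suc i)) n
    ≡⟨ θ-ones-⊛ 0 (ones i) n ⟩
  ∑< (a 0 ⊛ a (suc i)) n + ∑< (a 1 ⊛ a i) n
    ≡⟨ cong₂ _+_ (∑<-cong (⊛-identityˡ (a (suc i))) n)
         (trans (∑<-cong (1⊛ones i) n) (∑<-scale (+ suc i / 1) (a (suc i)) n)) ⟩
  ∑< (a (suc i)) n + (+ suc i / 1) * ∑< (a (suc i)) n
    ≡⟨ solve 2 (λ I x → x :+ I :* x := (I :+ con 1ℚ) :* x) refl (+ suc i / 1) (∑< (a (suc i)) n) ⟩
  (+ suc i / 1 + 1ℚ) * ∑< (a (suc i)) n
    ≡⟨ cong₂ _*_ (sym ([1+n]/1 (suc i))) (sym (θ-coeff-1 (ones (suc i)) n)) ⟩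
  (+ suc (suc i) / 1) * ((+ n / 1) * a (suc (suc i)) n)
    ≡⟨ solve 3 (λ I N x → I :* (N :* x) := N :* (I :* x)) refl (+ suc (suc i) / 1) (+ n / 1) (a (suc (suc i)) n) ⟩
  θ (λ m → (+ suc (suc i) / 1) * a (suc (suc i)) m) n ∎
  where
  open ≡-Reasoning
  a : ℕ → Series
  a i = coeff (ones i)

m<n⇒suc[n∸m∸1]≡n∸m : ∀ {m n} → m ℕ.< n → suc (n ∸ m ∸ 1) ≡ n ∸ m
m<n⇒suc[n∸m∸1]≡n∸m {m} {n} m<n = ℕ.m+[n∸m]≡n (ℕ.m<n⇒0<n∸m m<n)

-- The identity of power series.

-- θ of the alternating sum telescopes: the term that θ produces from the
-- second factor of one summand cancels the one from the first factor of the next.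
module _ (k′ : ℕ) where
  private
    k = suc k′
    a b : ℕ → Series
    a i = coeff (ones i)
    b m = coeff (ones m ++ plain 3 ∷ ones k′)
    d : Series
    d = coeff (plain 2 ∷ ones k′)
    X : ℕ → Series
    X i n = sign i * ∑< (a i ⊛ b (k ∸ i ∸ 1)) n

  θ-alternatingSum : ∀ j → j ℕ.≤ k′ → ∀ n →
    (+ n / 1) * ∑ℚ j (λ i → sign i * (a i ⊛ b (suc (k ∸ i ∸ 1))) n) ≡ X j n - X 0 n
  θ-alternatingSum zero    _ n = trans (*-zeroʳ (+ n / 1)) (sym (+-inverseʳ (X 0 n)))
  θ-alternatingSum (suc j) j<k′ n = begin
    N * (S + sign (suc j) * c)
      ≡⟨ solve 4 (λ N S s c → N :* (S :+ s :* c) := N :* S :+ s :* (N :* c)) refl N S (sign (suc j)) c ⟩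
    N * S + sign (suc j) * (N * c)
      ≡⟨ cong₂ (λ s t → s + sign (suc j) * t) (θ-alternatingSum j (ℕ.<⇒≤ j<k′) n)
           (θ-ones-⊛ j (ones (k ∸ suc j ∸ 1) ++ plain 3 ∷ ones k′) n) ⟩
    (X j n - X 0 n) + sign (suc j) * (∑< (a j ⊛ b (suc (k ∸ suc j ∸ 1))) n + q)
      ≡⟨ cong (λ m → (X j n - X 0 n) + sign (suc j) * (∑< (a j ⊛ b m) n + q)) index ⟩
    (X j n - X 0 n) + sign (suc j) * (p + q)
      ≡⟨ cong (λ s → (X j n - X 0 n) + s * (p + q)) (sign-suc j) ⟩
    (sign j * p - X 0 n) + - sign j * (p + q)
      ≡⟨ solve 4 (λ s p q z → (s :* p :- z) :+ (:- s) :* (p :+ q) := (:- s) :* q :- z) refl (sign j) p q (X 0 n) ⟩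
    - sign j * q - X 0 n
      ≡⟨ cong (λ s → s * q - X 0 n) (sym (sign-suc j)) ⟩
    X (suc j) n - X 0 n ∎
    where
    open ≡-Reasoning
    N = + n / 1
    S = ∑ℚ j (λ i → sign i * (a i ⊛ b (suc (k ∸ i ∸ 1))) n)
    c = (a (suc j) ⊛ b (suc (k ∸ suc j ∸ 1))) n
    p = ∑< (a j ⊛ b (k ∸ j ∸ 1)) n
    q = ∑< (a (suc j) ⊛ b (k ∸ suc j ∸ 1)) n
    -- For `j < k′` the truncated subtractions are exact, so the first product left by summand
    -- `suc j` is the one pending in `X j`.
    index : suc (k′ ∸ j ∸ 1) ≡ k ∸ j ∸ 1
    index = trans (m<n⇒suc[n∸m∸1]≡n∸m j<k′)
      (sym (cong (_∸ 1) (ℕ.+-∸-assoc 1 (ℕ.<⇒≤ j<k′))))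

  -- Of the alternating sum over `0 ≤ i ≤ k`, the summand `i = 0` is the left-hand side. The summand
  -- `i = k` stands apart: its second factor begins with 3, so `θ` lowers an exponent there and
  -- leaves `a k ⊛ d`, which the square cancels.
  series-identity : ∀ n → b k n ≡
    - ∑ℚ k′ (λ i → sign i * (a i ⊛ b (suc (k ∸ i ∸ 1))) n)
      - sign k * (a k ⊛ b 0) n + sign k * (½ * (d ⊛ d) n)
  series-identity = θ-injective (sym constant) λ n → sym (step n)
    where
    open ≡-Reasoning
    sum : Series
    sum n = ∑ℚ k′ (λ i → sign i * (a i ⊛ b (suc (k ∸ i ∸ 1))) n)

    sum-0 : ∀ j → ∑ℚ j (λ i → sign i * (a i ⊛ b (suc (k ∸ i ∸ 1))) 0) ≡ 0ℚ
    sum-0 zero    = refl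
    sum-0 (suc j) = cong₂ _+_ (sum-0 j) (*-zeroʳ (sign (suc j)))

    constant : - sum 0 - sign k * (a k ⊛ b 0) 0 + sign k * (½ * (d ⊛ d) 0) ≡ 0ℚ
    constant = trans
      (cong (λ t → - t - sign k * (a k ⊛ b 0) 0 + sign k * (½ * (d ⊛ d) 0)) (sum-0 k′))
      (solve 1 (λ s → :- con 0ℚ :- s :* con 0ℚ :+ s :* con 0ℚ := con 0ℚ) refl (sign k))

    step : ∀ n → (+ n / 1) * (- sum n - sign k * (a k ⊛ b 0) n + sign k * (½ * (d ⊛ d) n)) ≡ θ (b k) n
    step n = begin
      N * (- sum n - sign k * x + sign k * (½ * z))
        ≡⟨ solve 5 (λ N S s x z → N :* (:- S :- s :* x :+ s :* (con ½ :* z))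
             := :- (N :* S) :- s :* (N :* x) :+ s :* (con ½ :* (N :* z))) refl N (sum n) (sign k) x z ⟩
      - (N * sum n) - sign k * (N * x) + sign k * (½ * (N * z))
        ≡⟨ cong₂ (λ S x → - S - sign k * x + sign k * (½ * (N * z)))
             (θ-alternatingSum k′ ℕ.≤-refl n) θx ⟩
      - (X k′ n - X 0 n) - sign k * (q + y) + sign k * (½ * (N * z))
        -- The second factor in `X k′` is `b (k ∸ k′ ∸ 1)`, that is `b 0`.
        ≡⟨ cong₂ (λ m z → - (sign k′ * ∑< (a k′ ⊛ b (m ∸ 1)) n - X 0 n) - sign k * (q + y) + sign k * (½ * z))
             (ℕ.m+n∸n≡m 1 k′) θz ⟩
      - (sign k′ * q - X 0 n) - sign k * (q + y) + sign k * (½ * (y + y))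
        ≡⟨ cong (λ s → - (sign k′ * q - X 0 n) - s * (q + y) + s * (½ * (y + y))) (sign-suc k′) ⟩
      - (sign k′ * q - X 0 n) - - sign k′ * (q + y) + - sign k′ * (½ * (y + y))
        ≡⟨ solve 4 (λ s q y x → :- (s :* q :- x) :- (:- s) :* (q :+ y) :+ (:- s) :* (con ½ :* (y :+ y)) := x) refl
             (sign k′) q y (X 0 n) ⟩
      X 0 n
        ≡⟨ trans (*-identityˡ (∑< (a 0 ⊛ b k′) n)) (∑<-cong (⊛-identityˡ (b k′)) n) ⟩
      ∑< (b k′) n
        ≡⟨ sym (θ-coeff-1 (ones k′ ++ plain 3 ∷ ones k′) n) ⟩
      θ (b k) n ∎
      where
      N = + n / 1
      x = (a k ⊛ b 0) n
      y = (a k ⊛ d) n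
      z = (d ⊛ d) n
      q = ∑< (a k′ ⊛ b 0) n
      θx : N * x ≡ q + y
      θx = trans (θ-⊛ (a k) (b 0) n)
        (cong₂ _+_ (trans (⊛-cong {b = b 0} (θ-coeff-1 (ones k′)) (λ _ → refl) n) (∑<-⊛ˡ (a k′) (b 0) n))
                   (⊛-cong {a = a k} (λ _ → refl) (θ-coeff 2 (ones k′)) n))
      -- Lowering the 2 in `d` gives `k` ones, so `θ d` is `a k`.
      θz : N * z ≡ y + y
      θz = trans (θ-⊛ d d n)
        (cong₂ _+_ (⊛-cong {b = d} (θ-coeff 1 (ones k′)) (λ _ → refl) n)
                   (trans (⊛-cong {a = d} (λ _ → refl) (θ-coeff 1 (ones k′)) n) (⊛-comm d (a k) n)))

-- Null sequences.

null-cong : ∀ {a b : ℕ → ℚ} → (∀ n → a n ≡ b n) → Null a → Null b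
null-cong a≡b a→0 ε 0<ε with a→0 ε 0<ε
... | N , p = N , λ n le → subst (λ x → ∣ x ∣ < ε) (a≡b n) (p n le)

null-squeeze : ∀ {a b : ℕ → ℚ} → (∀ n → ∣ a n ∣ ≤ b n) → Null b → Null a
null-squeeze {b = b} ∣a∣≤b b→0 ε 0<ε with b→0 ε 0<ε
... | N , p = N , λ n le → ≤-<-trans (≤-trans (∣a∣≤b n) (p≤∣p∣ (b n))) (p n le)

null-0 : Null (λ _ → 0ℚ)
null-0 ε 0<ε = 0 , λ _ _ → 0<ε

cauchy*null : ∀ {c a : ℕ → ℚ} → Cauchy c → Null a → Null (λ n → c n * a n)
cauchy*null {c} {a} c-cauchy a→0 ε 0<ε = go (eventually-bounded {c} c-cauchy)
  where
  open ≤-Reasoning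
  go : (∃ λ b → ∃ λ N → 0ℚ ≤ b × (∀ n → N ℕ.≤ n → ∣ c n ∣ ≤ b)) →
    ∃ λ N → ∀ n → N ℕ.≤ n → ∣ c n * a n ∣ < ε
  go (b , M , 0≤b , ∣c∣≤b) = close (null-scale b {a} a→0 ε 0<ε)
    where
    close : (∃ λ N → ∀ n → N ℕ.≤ n → ∣ b * a n ∣ < ε) →
      ∃ λ N → ∀ n → N ℕ.≤ n → ∣ c n * a n ∣ < ε
    close (N , p) = M ℕ.⊔ N , λ n le → begin-strict
      ∣ c n * a n ∣      ≡⟨ ∣p*q∣≡∣p∣*∣q∣ (c n) (a n) ⟩
      ∣ c n ∣ * ∣ a n ∣  ≤⟨ *-mono (0≤∣p∣ (a n)) 0≤b (∣c∣≤b n (ℕ.≤-trans (ℕ.m≤m⊔n M N) le)) ≤-refl ⟩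
      b * ∣ a n ∣        ≡⟨ cong (_* ∣ a n ∣) (sym (0≤p⇒∣p∣≡p 0≤b)) ⟩
      ∣ b ∣ * ∣ a n ∣    ≡⟨ sym (∣p*q∣≡∣p∣*∣q∣ b (a n)) ⟩
      ∣ b * a n ∣        <⟨ p n (ℕ.≤-trans (ℕ.m≤n⊔m M N) le) ⟩
      ε                  ∎

p≤q+p : ∀ {p q} → 0ℚ ≤ q → p ≤ q + p
p≤q+p {p} {q} 0≤q = subst (p ≤_) (+-comm p q) (p≤p+q 0≤q)

-- Logarithmic growth, with `ℓ` in the role of the logarithm.

0≤harmonic : ∀ n → 0ℚ ≤ harmonic n
0≤harmonic zero    = ≤-refl
0≤harmonic (suc n) = +-nonNeg (0≤harmonic n) (0≤u n)

2ℚ : ℚ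
2ℚ = 1ℚ + 1ℚ

-- The summand 2 lets a power of ℓ absorb any constant factor.
ℓ : ℕ → ℚ
ℓ n = 2ℚ + harmonic n

infix 8 ℓ^_

ℓ^_ : ℕ → ℕ → ℚ
(ℓ^ zero)  n = 1ℚ
(ℓ^ suc r) n = ℓ n * (ℓ^ r) n

2≤ℓ : ∀ n → 2ℚ ≤ ℓ n
2≤ℓ n = p≤p+q {2ℚ} {harmonic n} (0≤harmonic n)

1≤ℓ : ∀ n → 1ℚ ≤ ℓ n
1≤ℓ n = ≤-trans (p≤p+q {1ℚ} {1ℚ} (<⇒≤ 0<1)) (2≤ℓ n)

0≤ℓ : ∀ n → 0ℚ ≤ ℓ n
0≤ℓ n = ≤-trans (<⇒≤ 0<1) (1≤ℓ n)

ℓ-suc : ∀ n → ℓ (suc n) ≡ ℓ n + u n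
ℓ-suc n = sym (+-assoc 2ℚ (harmonic n) (u n))

0≤ℓ^ : ∀ r n → 0ℚ ≤ (ℓ^ r) n
0≤ℓ^ zero    n = <⇒≤ 0<1
0≤ℓ^ (suc r) n = *-nonNeg (0≤ℓ n) (0≤ℓ^ r n)

p≤ℓp : ∀ n {p} → 0ℚ ≤ p → p ≤ ℓ n * p
p≤ℓp n {p} 0≤p = subst (_≤ ℓ n * p) (*-identityˡ p) (*-mono 0≤p (0≤ℓ n) (1≤ℓ n) ≤-refl)

p+p≤ℓp : ∀ n {p} → 0ℚ ≤ p → p + p ≤ ℓ n * p
p+p≤ℓp n {p} 0≤p = subst (_≤ ℓ n * p)
  (solve 1 (λ p → (con 1ℚ :+ con 1ℚ) :* p := p :+ p) refl p) (*-mono 0≤p (0≤ℓ n) (2≤ℓ n) ≤-refl)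

ℓ-monotone : ∀ n → ℓ n ≤ ℓ (suc n)
ℓ-monotone n = subst (ℓ n ≤_) (sym (ℓ-suc n)) (p≤p+q (0≤u n))

ℓ^-step : ∀ r n → (ℓ^ r) n ≤ (ℓ^ r) (suc n)
ℓ^-step zero    n = ≤-refl
ℓ^-step (suc r) n = *-mono (0≤ℓ^ r n) (0≤ℓ (suc n)) (ℓ-monotone n) (ℓ^-step r n)

ℓ^-monotone : ∀ r {m n} → m ℕ.≤ n → (ℓ^ r) m ≤ (ℓ^ r) n
ℓ^-monotone r {m} {n} m≤n = subst (λ k → (ℓ^ r) m ≤ (ℓ^ r) k) (ℕ.m∸n+n≡m m≤n) (go (n ∸ m))
  where
  go : ∀ d → (ℓ^ r) m ≤ (ℓ^ r) (d ℕ.+ m)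
  go zero    = ≤-refl
  go (suc d) = ≤-trans (go d) (ℓ^-step r (d ℕ.+ m))

ℓ^≤ℓ^+ : ∀ s r n → (ℓ^ r) n ≤ (ℓ^ (s ℕ.+ r)) n
ℓ^≤ℓ^+ zero    r n = ≤-refl
ℓ^≤ℓ^+ (suc s) r n = ≤-trans (ℓ^≤ℓ^+ s r n) (p≤ℓp n (0≤ℓ^ (s ℕ.+ r) n))

ℓ^-+ : ∀ s r n → (ℓ^ (s ℕ.+ r)) n ≡ (ℓ^ s) n * (ℓ^ r) n
ℓ^-+ zero    r n = sym (*-identityˡ ((ℓ^ r) n))
ℓ^-+ (suc s) r n = trans (cong (ℓ n *_) (ℓ^-+ s r n)) (sym (*-assoc (ℓ n) ((ℓ^ s) n) ((ℓ^ r) n)))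

-- The discrete counterpart of the derivative of `log^(r+1)` being `(r + 1) log^r / n`; the constant
-- is not sharp.
ℓ^-growth : ∀ r → ∃ λ c → 0ℚ ≤ c ×
  (∀ n → (ℓ^ suc r) (suc n) - (ℓ^ suc r) n ≤ c * ((ℓ^ r) n * u n))
ℓ^-growth zero = 1ℚ , <⇒≤ 0<1 , λ n → ≤-reflexive (trans
  (cong (λ t → t * 1ℚ - ℓ n * 1ℚ) (ℓ-suc n))
  (solve 2 (λ l v → (l :+ v) :* con 1ℚ :- l :* con 1ℚ := con 1ℚ :* (con 1ℚ :* v)) refl (ℓ n) (u n)))
ℓ^-growth (suc r) with ℓ^-growth r
-- The product rule gives three terms: `l * (x′ - x)` costs `c`, `x * v` costs 1, and `v * (x′ - x)`
-- costs `c` again because `u n ≤ 1 ≤ ℓ n`.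
... | c , 0≤c , growth = c + (1ℚ + c) , +-nonNeg 0≤c (+-nonNeg (<⇒≤ 0<1) 0≤c) , λ n →
  let
    open ≤-Reasoning
    l = ℓ n ; v = u n ; y = (ℓ^ r) n
    x = (ℓ^ suc r) n ; x′ = (ℓ^ suc r) (suc n)
    0≤Δ = p≤q⇒0≤q-p (ℓ^-step (suc r) n)
    lΔ≤ : l * (x′ - x) ≤ c * (x * v)
    lΔ≤ = begin
      l * (x′ - x)       ≤⟨ *-mono 0≤Δ (0≤ℓ n) ≤-refl (growth n) ⟩
      l * (c * (y * v))  ≡⟨ solve 4 (λ l c y v → l :* (c :* (y :* v)) := c :* (l :* y :* v)) refl l c y v ⟩
      c * (x * v)        ∎
  in begin
    ℓ (suc n) * x′ - l * x
      ≡⟨ cong (λ t → t * x′ - l * x) (ℓ-suc n) ⟩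
    (l + v) * x′ - l * x
      ≡⟨ solve 4 (λ l v x x′ → (l :+ v) :* x′ :- l :* x := l :* (x′ :- x) :+ (x :* v :+ v :* (x′ :- x))) refl l v x x′ ⟩
    l * (x′ - x) + (x * v + v * (x′ - x))
      ≤⟨ +-mono-≤ lΔ≤ (+-monoʳ-≤ (x * v) (≤-trans
           (*-mono 0≤Δ (0≤ℓ n) (≤-trans (u≤1 n) (1≤ℓ n)) ≤-refl) lΔ≤)) ⟩
    c * (x * v) + (x * v + c * (x * v))
      ≡⟨ solve 2 (λ c w → c :* w :+ (w :+ c :* w) := (c :+ (con 1ℚ :+ c)) :* w) refl c (x * v) ⟩
    (c + (1ℚ + c)) * (x * v) ∎

-- By `ℓ^-growth` the increments of the next power are null by induction, and `cesàro` passes from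
-- null increments to a null average.
null-ℓ^u : ∀ r → Null (λ n → (ℓ^ r) n * u n)
null-ℓ^u zero    = null-scale 1ℚ null-u
null-ℓ^u (suc r) with ℓ^-growth r
... | c , 0≤c , growth = cesàro p (λ n → p (suc n) - p n) (0≤ℓ^ (suc r))
  (λ n → solve 2 (λ x y → y := x :+ (y :- x)) refl (p n) (p (suc n)))
  (null-squeeze
    (λ n → ≤-trans (≤-reflexive (0≤p⇒∣p∣≡p (p≤q⇒0≤q-p (ℓ^-step (suc r) n)))) (growth n))
    (null-scale c {λ n → (ℓ^ r) n * u n} (null-ℓ^u r)))
  where
  p : ℕ → ℚ
  p = ℓ^ suc r

A≤ℓ^ : ∀ j n → A j n ≤ (ℓ^ j) n
-- Keeping one factor as `harmonic` leaves the summand 2 of `ℓ` free; `F≤ℓ^u` uses it to absorb the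
-- terms of lower depth.
A-suc≤hℓ^ : ∀ j n → A (suc j) n ≤ harmonic n * (ℓ^ j) n

A≤ℓ^ zero    n = ≤-refl
A≤ℓ^ (suc j) n = ≤-trans (A-suc≤hℓ^ j n)
  (*-mono (0≤ℓ^ j n) (0≤ℓ n) (p≤q+p {harmonic n} {2ℚ} (<⇒≤ (+-mono-< 0<1 0<1))) ≤-refl)

A-suc≤hℓ^ j zero    = ≤-reflexive (sym (*-zeroˡ ((ℓ^ j) 0)))
A-suc≤hℓ^ j (suc n) = begin
  A (suc j) n + A j n * u n
    ≤⟨ +-mono-≤ (A-suc≤hℓ^ j n) (*-mono (0≤u n) (0≤ℓ^ j n) (A≤ℓ^ j n) ≤-refl) ⟩
  harmonic n * (ℓ^ j) n + (ℓ^ j) n * u n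
    ≡⟨ solve 3 (λ h x v → h :* x :+ x :* v := (h :+ v) :* x) refl (harmonic n) ((ℓ^ j) n) (u n) ⟩
  harmonic (suc n) * (ℓ^ j) n
    ≤⟨ *-mono (0≤ℓ^ j n) (0≤harmonic (suc n)) ≤-refl (ℓ^-step j n) ⟩
  harmonic (suc n) * (ℓ^ j) (suc n) ∎
  where open ≤-Reasoning

F≤ℓ^u : ∀ j n → F j n ≤ (ℓ^ j) n * u n
F≤ℓ^u zero    n = ≤-refl
F≤ℓ^u (suc j) n = begin
  F j n + A (suc j) n * v    ≤⟨ +-mono-≤ (F≤ℓ^u j n) (*-mono (0≤u n) (*-nonNeg (0≤harmonic n) (0≤ℓ^ j n)) (A-suc≤hℓ^ j n) ≤-refl) ⟩
  x * v + h * x * v          ≤⟨ p≤q+p (*-nonNeg (0≤ℓ^ j n) (0≤u n)) ⟩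
  x * v + (x * v + h * x * v) ≡⟨ solve 3 (λ x v h → x :* v :+ (x :* v :+ h :* x :* v)
                                  := (con 1ℚ :+ con 1ℚ :+ h) :* x :* v) refl x v h ⟩
  ℓ n * x * v                ∎
  where
  open ≤-Reasoning
  x = (ℓ^ j) n
  v = u n
  h = harmonic n

-- `∣factor∣≤u` bounds the factor at `suc n` by `u n`, not `u (suc n)`; the resulting 2 costs one
-- power of `ℓ`, so the exponent is the full length.
∣coeff∣≤ : ∀ es n → ∣ coeff es n ∣ ≤ (ℓ^ length es) n * u n
∣coeff∣≤ []       zero    = ≤-refl
∣coeff∣≤ []       (suc n) = subst (0ℚ ≤_) (sym (*-identityˡ (u (suc n)))) (0≤u (suc n))
∣coeff∣≤ (e ∷ es) zero    = *-nonNeg (0≤ℓ^ (suc (length es)) 0) (0≤u 0)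
∣coeff∣≤ (e ∷ es) (suc n) = begin
  ∣ f * y ∣                            ≡⟨ trans (∣p*q∣≡∣p∣*∣q∣ f y) (*-comm ∣ f ∣ ∣ y ∣) ⟩
  ∣ y ∣ * ∣ f ∣                        ≤⟨ *-mono (0≤∣p∣ f) (0≤ℓ^ r (suc n))
                                            (≤-trans (∣zetaSum∣≤A es n) (≤-trans (A≤ℓ^ r n) (ℓ^-step r n)))
                                            (≤-trans (∣factor∣≤u e n) (u≤2u-suc n)) ⟩
  x * (u (suc n) + u (suc n))          ≡⟨ *-distribˡ-+ x (u (suc n)) (u (suc n)) ⟩
  x * u (suc n) + x * u (suc n)        ≤⟨ p+p≤ℓp (suc n) (*-nonNeg (0≤ℓ^ r (suc n)) (0≤u (suc n))) ⟩
  ℓ (suc n) * (x * u (suc n))          ≡⟨ sym (*-assoc (ℓ (suc n)) x (u (suc n))) ⟩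
  (ℓ^ suc r) (suc n) * u (suc n)       ∎
  where
  open ≤-Reasoning
  r = length es
  f = factor e (suc n)
  y = zetaSum es n
  x = (ℓ^ r) (suc n)

-- Tails of alternating sums.

∣p*q∣≤ : ∀ {p q x y} → ∣ p ∣ ≤ x → ∣ q ∣ ≤ y → ∣ p * q ∣ ≤ x * y
∣p*q∣≤ {p} {q} {x} {y} ∣p∣≤x ∣q∣≤y = subst (_≤ x * y) (sym (∣p*q∣≡∣p∣*∣q∣ p q))
  (*-mono (0≤∣p∣ q) (≤-trans (0≤∣p∣ p) ∣p∣≤x) ∣p∣≤x ∣q∣≤y)

∣sign*p∣ : ∀ k p → ∣ sign k * p ∣ ≡ ∣ p ∣
∣sign*p∣ k p = trans (∣p*q∣≡∣p∣*∣q∣ (sign k) p)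
  (trans (cong (_* ∣ p ∣) (∣sign∣ k)) (*-identityˡ ∣ p ∣))

-- The averaged partial sums z n + ½ (± c n) converge absolutely.
alternating-tail : ∀ {z c f : ℕ → ℚ} →
  (∀ n → z (suc n) - z n ≡ sign (suc n) * c n) →
  (∀ n → ∣ c n ∣ ≤ f n) →
  (∀ n → ∣ c n - c (suc n) ∣ ≤ f n - f (suc n)) →
  ∀ n d → ∣ z (d ℕ.+ n) - z n ∣ ≤ f n
alternating-tail {z} {c} {f} z-step ∣c∣≤f ∣Δc∣≤ n d = begin
  ∣ z m - z n ∣
    ≡⟨ cong ∣_∣ (solve 4 (λ x y v v′ → x :- y := ((x :+ v) :- (y :+ v′)) :+ (v′ :- v)) refl
         (z m) (z n) (h m) (h n)) ⟩
  ∣ (w m - w n) + (h n - h m) ∣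
    ≤⟨ ∣p+q∣≤∣p∣+∣q∣ (w m - w n) (h n - h m) ⟩
  ∣ w m - w n ∣ + ∣ h n - h m ∣
    ≤⟨ +-mono-≤ (telescope {w} {λ k → ½ * f k} w-step n d)
         (≤-trans (∣p-q∣≤∣p∣+∣q∣ (h n) (h m)) (+-mono-≤ (∣h∣≤ n) (∣h∣≤ m))) ⟩
  (½ * f n - ½ * f m) + (½ * f n + ½ * f m)
    ≡⟨ solve 2 (λ x y → (con ½ :* x :- con ½ :* y) :+ (con ½ :* x :+ con ½ :* y) := x) refl (f n) (f m) ⟩
  f n ∎
  where
  open ≤-Reasoning
  m = d ℕ.+ n
  h w : ℕ → ℚ
  h k = ½ * (sign (suc k) * c k)
  w k = z k + h k
  ∣h∣≤ : ∀ k → ∣ h k ∣ ≤ ½ * f k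
  ∣h∣≤ k = ∣p*q∣≤ {½} {sign (suc k) * c k} ≤-refl
    (≤-trans (≤-reflexive (∣sign*p∣ (suc k) (c k))) (∣c∣≤f k))
  w-step : ∀ k → ∣ w (suc k) - w k ∣ ≤ ½ * f k - ½ * f (suc k)
  w-step k = begin
    ∣ (z (suc k) + ½ * (sign (suc (suc k)) * c (suc k))) - (z k + ½ * (s * c k)) ∣
      ≡⟨ cong (λ t → ∣ (z (suc k) + ½ * (t * c (suc k))) - (z k + ½ * (s * c k)) ∣) (sign-suc (suc k)) ⟩
    ∣ (z (suc k) + ½ * (- s * c (suc k))) - (z k + ½ * (s * c k)) ∣
      ≡⟨ cong ∣_∣ (solve 5 (λ z′ z s c c′ → (z′ :+ con ½ :* ((:- s) :* c′)) :- (z :+ con ½ :* (s :* c))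
           := (z′ :- z) :- con ½ :* (s :* (c :+ c′))) refl (z (suc k)) (z k) s (c k) (c (suc k))) ⟩
    ∣ (z (suc k) - z k) - ½ * (s * (c k + c (suc k))) ∣
      ≡⟨ cong (λ t → ∣ t - ½ * (s * (c k + c (suc k))) ∣) (z-step k) ⟩
    ∣ s * c k - ½ * (s * (c k + c (suc k))) ∣
      ≡⟨ cong ∣_∣ (solve 3 (λ s c c′ → s :* c :- con ½ :* (s :* (c :+ c′)) := con ½ :* (s :* (c :- c′))) refl
           s (c k) (c (suc k))) ⟩
    ∣ ½ * (s * (c k - c (suc k))) ∣
      ≤⟨ ∣p*q∣≤ {½} {s * (c k - c (suc k))} ≤-refl
           (≤-trans (≤-reflexive (∣sign*p∣ (suc k) (c k - c (suc k)))) (∣Δc∣≤ k)) ⟩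
    ½ * (f k - f (suc k))
      ≡⟨ solve 2 (λ x y → con ½ :* (x :- y) := con ½ :* x :- con ½ :* y) refl (f k) (f (suc k)) ⟩
    ½ * f k - ½ * f (suc k) ∎
    where s = sign (suc k)

module _ (es : List Entry) where
  private
    open ≤-Reasoning
    r r′ : ℕ
    r = length es
    r′ = ℕ.pred r

    -- `G s` is built so that its decrements dominate the variation of `c s`: by the product rule,
    -- the difference of `u * c s` has one part telescoped by `F r` and one by `G s`.
    c G : ℕ → ℕ → ℚ
    c s n = pow s n * zetaSum es n
    G zero    n = F r′ n
    G (suc s) n = F r n + G s n

    0≤G : ∀ s n → 0ℚ ≤ G s n
    0≤G zero    n = 0≤F r′ n
    0≤G (suc s) n = +-nonNeg (0≤F r n) (0≤G s n)

    ∣c∣≤G : ∀ s n → ∣ c (suc s) n ∣ ≤ G (suc s) n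
    ∣c∣≤G s n = begin
      ∣ pow (suc s) n * zetaSum es n ∣  ≤⟨ ∣p*q∣≤ {pow (suc s) n}
                                             (≤-trans (≤-reflexive (0≤p⇒∣p∣≡p (0≤pow (suc s) n))) (pow≤u s n))
                                             (∣zetaSum∣≤A es n) ⟩
      u n * A r n                       ≡⟨ *-comm (u n) (A r n) ⟩
      A r n * u n                       ≤⟨ Au≤F r n ⟩
      F r n                             ≤⟨ p≤p+q (0≤G s n) ⟩
      G (suc s) n                       ∎

    -- The weight serves `s = 0`, where `c 0` is the partial sum itself: the bound `A r′ n * u n` on
    -- its increments becomes a decrement of `F r′` only after this multiplication.
    uΔc≤ : ∀ s n → u (suc n) * ∣ c s n - c s (suc n) ∣ ≤ G s n - G s (suc n)
    Δc≤ : ∀ s n → ∣ c (suc s) n - c (suc s) (suc n) ∣ ≤ G (suc s) n - G (suc s) (suc n)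

    uΔc≤ zero n = begin
      q * ∣ 1ℚ * y - 1ℚ * y′ ∣  ≡⟨ cong (λ t → q * ∣ t ∣) (solve 2 (λ y y′ → con 1ℚ :* y :- con 1ℚ :* y′ := y :- y′) refl y y′) ⟩
      q * ∣ y - y′ ∣            ≡⟨ cong (q *_) (∣p-q∣≡∣q-p∣ y y′) ⟩
      q * ∣ y′ - y ∣            ≤⟨ *-monoˡ-≤-nonNeg q {{ℚ.nonNegative (0≤u (suc n))}} (∣zetaSum-step∣≤′ es n) ⟩
      q * (A r′ n * u n)        ≡⟨ solve 3 (λ q a p → q :* (a :* p) := a :* (p :* q)) refl q (A r′ n) (u n) ⟩
      A r′ n * (u n * q)        ≡⟨ sym (F-diff r′ n) ⟩
      F r′ n - F r′ (suc n)     ∎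
      where
      q = u (suc n)
      y = zetaSum es n
      y′ = zetaSum es (suc n)
    uΔc≤ (suc s) n = begin
      u (suc n) * d   ≤⟨ *-mono (0≤∣p∣ (c (suc s) n - c (suc s) (suc n))) (<⇒≤ 0<1) (u≤1 (suc n)) ≤-refl ⟩
      1ℚ * d          ≡⟨ *-identityˡ d ⟩
      d               ≤⟨ Δc≤ s n ⟩
      G (suc s) n - G (suc s) (suc n) ∎
      where d = ∣ c (suc s) n - c (suc s) (suc n) ∣

    Δc≤ s n = begin
      ∣ pow (suc s) n * y - pow (suc s) (suc n) * y′ ∣
        ≡⟨ cong₂ (λ v w → ∣ v * y - w * y′ ∣) (pow-suc s n) (pow-suc s (suc n)) ⟩
      ∣ p * P * y - q * P′ * y′ ∣
        ≡⟨ cong ∣_∣ (solve 6 (λ p q P P′ y y′ → p :* P :* y :- q :* P′ :* y′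
             := P :* y :* (p :- q) :+ q :* (P :* y :- P′ :* y′)) refl p q P P′ y y′) ⟩
      ∣ P * y * (p - q) + q * (P * y - P′ * y′) ∣
        ≤⟨ ∣p+q∣≤∣p∣+∣q∣ (P * y * (p - q)) (q * (P * y - P′ * y′)) ⟩
      ∣ P * y * (p - q) ∣ + ∣ q * (P * y - P′ * y′) ∣
        ≤⟨ +-mono-≤ first second ⟩
      (F r n - F r (suc n)) + (G s n - G s (suc n))
        ≡⟨ solve 4 (λ a b c d → (a :- b) :+ (c :- d) := (a :+ c) :- (b :+ d)) refl
             (F r n) (F r (suc n)) (G s n) (G s (suc n)) ⟩
      G (suc s) n - G (suc s) (suc n) ∎
      where
      p = u n
      q = u (suc n)
      P = pow s n
      P′ = pow s (suc n)
      y = zetaSum es n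
      y′ = zetaSum es (suc n)
      ∣Py∣≤ : ∣ P * y ∣ ≤ 1ℚ * A r n
      ∣Py∣≤ = ∣p*q∣≤ {P} {y} (≤-trans (≤-reflexive (0≤p⇒∣p∣≡p (0≤pow s n))) (pow≤1 s n)) (∣zetaSum∣≤A es n)
      first : ∣ P * y * (p - q) ∣ ≤ F r n - F r (suc n)
      first = begin
        ∣ P * y * (p - q) ∣       ≡⟨ cong (λ t → ∣ P * y * t ∣) (u-diff n) ⟩
        ∣ P * y * (p * q) ∣       ≤⟨ ∣p*q∣≤ {P * y} {p * q} ∣Py∣≤
                                       (≤-reflexive (0≤p⇒∣p∣≡p (*-nonNeg (0≤u n) (0≤u (suc n))))) ⟩
        1ℚ * A r n * (p * q)      ≡⟨ cong (_* (p * q)) (*-identityˡ (A r n)) ⟩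
        A r n * (p * q)           ≡⟨ sym (F-diff r n) ⟩
        F r n - F r (suc n)       ∎
      second : ∣ q * (P * y - P′ * y′) ∣ ≤ G s n - G s (suc n)
      second = begin
        ∣ q * (P * y - P′ * y′) ∣     ≡⟨ ∣p*q∣≡∣p∣*∣q∣ q (P * y - P′ * y′) ⟩
        ∣ q ∣ * ∣ P * y - P′ * y′ ∣   ≡⟨ cong (_* ∣ P * y - P′ * y′ ∣) (0≤p⇒∣p∣≡p (0≤u (suc n))) ⟩
        q * ∣ P * y - P′ * y′ ∣       ≤⟨ uΔc≤ s n ⟩
        G s n - G s (suc n)           ∎

    ℓ^pred≤ : ∀ j n → (ℓ^ ℕ.pred j) n ≤ (ℓ^ j) n
    ℓ^pred≤ zero    n = ≤-refl
    ℓ^pred≤ (suc j) n = p≤ℓp n (0≤ℓ^ j n)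

    G≤ℓ^u : ∀ s n → G s n ≤ (ℓ^ (s ℕ.+ r)) n * u n
    G≤ℓ^u zero    n = ≤-trans (F≤ℓ^u r′ n) (*-mono (0≤u n) (0≤ℓ^ r n) (ℓ^pred≤ r n) ≤-refl)
    G≤ℓ^u (suc s) n = begin
      F r n + G s n                ≤⟨ +-mono-≤ (≤-trans (F≤ℓ^u r n)
                                        (*-mono (0≤u n) (0≤ℓ^ (s ℕ.+ r) n) (ℓ^≤ℓ^+ s r n) ≤-refl)) (G≤ℓ^u s n) ⟩
      x * u n + x * u n            ≤⟨ p+p≤ℓp n (*-nonNeg (0≤ℓ^ (s ℕ.+ r) n) (0≤u n)) ⟩
      ℓ n * (x * u n)              ≡⟨ sym (*-assoc (ℓ n) x (u n)) ⟩
      ℓ n * x * u n                ∎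
      where x = (ℓ^ (s ℕ.+ r)) n

  zetaSum-bar-tail : ∀ s n d →
    ∣ zetaSum (bar (suc s) ∷ es) (d ℕ.+ n) - zetaSum (bar (suc s) ∷ es) n ∣
      ≤ (ℓ^ (suc s ℕ.+ r)) n * u n
  zetaSum-bar-tail s n d = ≤-trans
    (alternating-tail {zetaSum (bar (suc s) ∷ es)} {c (suc s)} {G (suc s)}
      (λ k → trans (zetaSum-step (bar (suc s)) es k)
        (trans (cong (_* zetaSum es k) (factor-bar (suc s) k))
               (*-assoc (sign (suc k)) (pow (suc s) k) (zetaSum es k))))
      (∣c∣≤G s) (Δc≤ s) n d)
    (G≤ℓ^u (suc s) n)

-- Values at `x = -1` and their products.

LogBounded : Series → Set
LogBounded a = ∃ λ r → ∀ n → ∣ a n ∣ ≤ (ℓ^ r) n * u n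

-- A rate is recorded because the error of a Cauchy product convolves the tails at all `m ≤ n` with
-- coefficients.
LogConvergent : (ℕ → ℚ) → Set
LogConvergent z = ∃ λ r → ∀ n d → ∣ z (d ℕ.+ n) - z n ∣ ≤ (ℓ^ r) n * u n

logConvergent⇒cauchy : ∀ {z} → LogConvergent z → Cauchy z
logConvergent⇒cauchy {z} (r , bound) = bounded⇒cauchy {z} {λ n → (ℓ^ r) n * u n} (null-ℓ^u r) bound

alternate : Series → Series
alternate a n = sign n * a n

-- Partial sums of the power series at x = -1.
eval : Series → ℕ → ℚ
eval a n = ∑< (alternate a) (suc n)

eval-coeff-[] : ∀ n → eval (coeff []) n ≡ 1ℚ
eval-coeff-[] zero    = refl
eval-coeff-[] (suc n) = cong₂ _+_ (eval-coeff-[] n) (*-zeroʳ (sign (suc n)))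

eval-coeff : ∀ s .{{_ : NonZero s}} es n → eval (coeff (plain s ∷ es)) n ≡ zetaSum (bar s ∷ es) n
eval-coeff s es zero    = refl
eval-coeff s es (suc n) = cong₂ _+_ (eval-coeff s es n)
  (trans (sym (*-assoc (sign (suc n)) (pow s n) (zetaSum es n)))
         (cong (_* zetaSum es n) (sym (factor-bar s n))))

coeff-logBounded : ∀ es → LogBounded (coeff es)
coeff-logBounded es = length es , ∣coeff∣≤ es

coeff-logConvergent : ∀ s es → LogConvergent (eval (coeff (plain (suc s) ∷ es)))
coeff-logConvergent s es = suc s ℕ.+ length es , λ n d →
  subst (_≤ (ℓ^ (suc s ℕ.+ length es)) n * u n)
    (cong₂ (λ x y → ∣ x - y ∣) (sym (eval-coeff (suc s) es (d ℕ.+ n))) (sym (eval-coeff (suc s) es n)))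
    (zetaSum-bar-tail es s n d)

ones-logConvergent : ∀ i → LogConvergent (eval (coeff (ones i)))
ones-logConvergent (suc i) = coeff-logConvergent 0 (ones i)
ones-logConvergent zero    = 0 , λ n d →
  subst (_≤ 1ℚ * u n)
    (cong₂ (λ x y → ∣ x - y ∣) (sym (eval-coeff-[] (d ℕ.+ n))) (sym (eval-coeff-[] n)))
    (subst (0ℚ ≤_) (sym (*-identityˡ (u n))) (0≤u n))

alternate-⊛ : ∀ a b n → (alternate a ⊛ alternate b) n ≡ alternate (a ⊛ b) n
alternate-⊛ a b zero    = solve 2 (λ x y → con 1ℚ :* x :* (con 1ℚ :* y) := con 1ℚ :* (x :* y)) refl (a 0) (b 0)
alternate-⊛ a b (suc n) = begin
  1ℚ * x * (sign (suc n) * y) + ((alternate a ∘ suc) ⊛ alternate b) n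
    ≡⟨ cong₂ (λ s t → 1ℚ * x * (s * y) + t) (sign-suc n)
         (trans (⊛-cong {b = alternate b} shift (λ _ → refl) n) (⊛-scaleˡ (- 1ℚ) (alternate (a ∘ suc)) (alternate b) n)) ⟩
  1ℚ * x * (- sign n * y) + - 1ℚ * (alternate (a ∘ suc) ⊛ alternate b) n
    ≡⟨ cong (λ t → 1ℚ * x * (- sign n * y) + - 1ℚ * t) (alternate-⊛ (a ∘ suc) b n) ⟩
  1ℚ * x * (- sign n * y) + - 1ℚ * (sign n * c)
    ≡⟨ solve 4 (λ x y s c → con 1ℚ :* x :* ((:- s) :* y) :+ con (- 1ℚ) :* (s :* c) := (:- s) :* (x :* y :+ c)) refl
         x y (sign n) c ⟩
  - sign n * (x * y + c)
    ≡⟨ cong (_* (x * y + c)) (sym (sign-suc n)) ⟩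
  alternate (a ⊛ b) (suc n) ∎
  where
  open ≡-Reasoning
  x = a 0
  y = b (suc n)
  c = ((a ∘ suc) ⊛ b) n
  shift : ∀ m → alternate a (suc m) ≡ - 1ℚ * alternate (a ∘ suc) m
  shift m = trans (cong (_* a (suc m)) (sign-suc m))
    (solve 2 (λ s x → (:- s) :* x := con (- 1ℚ) :* (s :* x)) refl (sign m) (a (suc m)))

-- Taking partial sums is multiplication by `1 / (1 - x)`, which may be applied to one factor of a
-- product.
eval-⊛ : ∀ a b n → eval (a ⊛ b) n ≡ (alternate a ⊛ eval b) n
eval-⊛ a b n = begin
  ∑< (alternate (a ⊛ b)) (suc n)                        ≡⟨ ∑<-cong (λ m → sym (alternate-⊛ a b m)) (suc n) ⟩
  ∑< (alternate a ⊛ alternate b) (suc n)                ≡⟨ sym (∑<-⊛ʳ (alternate a) (alternate b) (suc n)) ⟩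
  (alternate a ⊛ ∑< (alternate b)) (suc n)              ≡⟨ ⊛-unfoldʳ (alternate a) (∑< (alternate b)) n ⟩
  (alternate a ⊛ eval b) n + alternate a (suc n) * 0ℚ   ≡⟨ cong (_+_ ((alternate a ⊛ eval b) n)) (*-zeroʳ (alternate a (suc n))) ⟩
  (alternate a ⊛ eval b) n + 0ℚ                         ≡⟨ +-identityʳ ((alternate a ⊛ eval b) n) ⟩
  (alternate a ⊛ eval b) n                              ∎
  where open ≡-Reasoning

-- `eval a n * eval b n` is itself a convolution, of `alternate a` with the constant `eval b n`, so
-- only tails of `b` remain.
eval-⊛-error : ∀ a b n → eval (a ⊛ b) n - eval a n * eval b n ≡
  (alternate a ⊛ (λ m → eval b m - eval b n)) n
eval-⊛-error a b n = begin
  eval (a ⊛ b) n - eval a n * eval b n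
    ≡⟨ cong₂ _+_ (eval-⊛ a b n) (neg-distribʳ-* (eval a n) (eval b n)) ⟩
  (alternate a ⊛ eval b) n + eval a n * - eval b n
    ≡⟨ cong (_+_ ((alternate a ⊛ eval b) n)) (sym (⊛-constʳ (alternate a) (- eval b n) n)) ⟩
  (alternate a ⊛ eval b) n + (alternate a ⊛ (λ _ → - eval b n)) n
    ≡⟨ sym (⊛-distribˡ (alternate a) (eval b) (λ _ → - eval b n) n) ⟩
  (alternate a ⊛ (λ m → eval b m - eval b n)) n ∎
  where open ≡-Reasoning

∣⊛∣≤ : ∀ {a b α β : Series} n → (∀ i → i ℕ.≤ n → ∣ a i ∣ ≤ α i) →
  (∀ i → i ℕ.≤ n → ∣ b i ∣ ≤ β i) → ∣ (a ⊛ b) n ∣ ≤ (α ⊛ β) n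
∣⊛∣≤ {a} {b} zero    p q = ∣p*q∣≤ {a 0} {b 0} (p 0 ℕ.z≤n) (q 0 ℕ.z≤n)
∣⊛∣≤ {a} {b} (suc n) p q = ≤-trans
  (∣p+q∣≤∣p∣+∣q∣ (a 0 * b (suc n)) (((a ∘ suc) ⊛ b) n))
  (+-mono-≤ (∣p*q∣≤ {a 0} {b (suc n)} (p 0 ℕ.z≤n) (q (suc n) ℕ.≤-refl))
    (∣⊛∣≤ {a ∘ suc} {b} n (λ i i≤n → p (suc i) (ℕ.s≤s i≤n)) (λ i i≤n → q i (ℕ.m≤n⇒m≤1+n i≤n))))

∑<-u : ∀ n → ∑< u n ≡ harmonic n
∑<-u zero    = refl
∑<-u (suc n) = cong (_+ u n) (∑<-u n)

-- Partial fractions by way of `θ`: since `θ u + u` is constantly 1, the Leibniz rule turns `n + 2`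
-- times the coefficient into twice the convolution of 1 with `u`.
u⊛u : ∀ n → (u ⊛ u) n ≡ u (suc n) * (harmonic (suc n) + harmonic (suc n))
u⊛u n = begin
  c
    ≡⟨ sym (u*[1+n]* (suc n) c) ⟩
  u (suc n) * ((+ suc (suc n) / 1) * c)
    ≡⟨ cong (λ t → u (suc n) * (t * c)) (trans ([1+n]/1 (suc n)) (cong (_+ 1ℚ) ([1+n]/1 n))) ⟩
  u (suc n) * ((+ n / 1 + 1ℚ + 1ℚ) * c)
    ≡⟨ cong (u (suc n) *_) (solve 2 (λ N c → (N :+ con 1ℚ :+ con 1ℚ) :* c := N :* c :+ (c :+ c)) refl (+ n / 1) c) ⟩
  u (suc n) * (θ (u ⊛ u) n + (c + c))
    ≡⟨ cong (λ t → u (suc n) * (t + (c + c)))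
         (trans (θ-⊛ u u n) (cong (_+_ ((θ u ⊛ u) n)) (⊛-comm u (θ u) n))) ⟩
  u (suc n) * ((θ u ⊛ u) n + (θ u ⊛ u) n + (c + c))
    ≡⟨ cong (u (suc n) *_) (solve 2 (λ x c → x :+ x :+ (c :+ c) := (x :+ c) :+ (x :+ c)) refl ((θ u ⊛ u) n) c) ⟩
  u (suc n) * (((θ u ⊛ u) n + c) + ((θ u ⊛ u) n + c))
    ≡⟨ cong (λ t → u (suc n) * (t + t)) sum ⟩
  u (suc n) * (harmonic (suc n) + harmonic (suc n)) ∎
  where
  open ≡-Reasoning
  c = (u ⊛ u) n
  θu+u : ∀ m → θ u m + u m ≡ 1ℚ
  θu+u m = trans (solve 2 (λ M v → M :* v :+ v := (M :+ con 1ℚ) :* v) refl (+ m / 1) (u m))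
    (trans (cong (_* u m) (sym ([1+n]/1 m))) ([1+n]*u m))
  sum : (θ u ⊛ u) n + c ≡ harmonic (suc n)
  sum = begin
    (θ u ⊛ u) n + (u ⊛ u) n            ≡⟨ sym (⊛-distribʳ (θ u) u u n) ⟩
    ((λ m → θ u m + u m) ⊛ u) n        ≡⟨ ⊛-cong {b = u} θu+u (λ _ → refl) n ⟩
    ((λ _ → 1ℚ) ⊛ u) n                 ≡⟨ ⊛-comm (λ _ → 1ℚ) u n ⟩
    (u ⊛ (λ _ → 1ℚ)) n                 ≡⟨ ⊛-constʳ u 1ℚ n ⟩
    ∑< u (suc n) * 1ℚ                  ≡⟨ *-identityʳ (∑< u (suc n)) ⟩
    ∑< u (suc n)                       ≡⟨ ∑<-u (suc n) ⟩
    harmonic (suc n)                   ∎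

u⊛u≤ : ∀ n → (u ⊛ u) n ≤ (ℓ^ 2) n * u n
u⊛u≤ n = begin
  (u ⊛ u) n                      ≡⟨ u⊛u n ⟩
  u (suc n) * (h + h)            ≤⟨ *-mono (+-nonNeg 0≤h 0≤h) (0≤u n) (u-suc≤u n) (+-mono-≤ h≤ℓ h≤ℓ) ⟩
  u n * (ℓ n + ℓ n)              ≤⟨ *-monoˡ-≤-nonNeg (u n) {{ℚ.nonNegative (0≤u n)}} (p+p≤ℓp n (0≤ℓ n)) ⟩
  u n * (ℓ n * ℓ n)              ≡⟨ solve 2 (λ v l → v :* (l :* l) := l :* (l :* con 1ℚ) :* v) refl (u n) (ℓ n) ⟩
  (ℓ^ 2) n * u n                 ∎
  where
  open ≤-Reasoning
  h = harmonic (suc n)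
  0≤h = 0≤harmonic (suc n)
  h≤ℓ : h ≤ ℓ n
  h≤ℓ = begin
    harmonic n + u n    ≤⟨ +-monoʳ-≤ (harmonic n) (≤-trans (u≤1 n) (p≤p+q {1ℚ} {1ℚ} (<⇒≤ 0<1))) ⟩
    harmonic n + 2ℚ     ≡⟨ +-comm (harmonic n) 2ℚ ⟩
    ℓ n                 ∎

-- Monotonicity allows the logarithmic factors to be frozen at `n`. What remains is `u ⊛ u`, which
-- costs two more powers of `ℓ` and keeps the factor `u n`.
eval-⊛-null : ∀ {a b} → LogBounded a → LogConvergent (eval b) →
  Null (λ n → eval (a ⊛ b) n - eval a n * eval b n)
eval-⊛-null {a} {b} (r , ∣a∣≤) (s , tail) = null-squeeze error≤ (null-ℓ^u (r ℕ.+ (s ℕ.+ 2)))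
  where
  open ≤-Reasoning
  error≤ : ∀ n → ∣ eval (a ⊛ b) n - eval a n * eval b n ∣ ≤ (ℓ^ (r ℕ.+ (s ℕ.+ 2))) n * u n
  error≤ n = begin
    ∣ eval (a ⊛ b) n - eval a n * eval b n ∣
      ≡⟨ cong ∣_∣ (eval-⊛-error a b n) ⟩
    ∣ (alternate a ⊛ (λ m → eval b m - eval b n)) n ∣
      ≤⟨ ∣⊛∣≤ {alternate a} {λ m → eval b m - eval b n} n ∣alternate∣≤ ∣tail∣≤ ⟩
    ((λ m → x * u m) ⊛ (λ m → y * u m)) n
      ≡⟨ trans (⊛-scaleˡ x u (λ m → y * u m) n) (cong (x *_) (⊛-scaleʳ y u u n)) ⟩
    x * (y * (u ⊛ u) n)
      ≤⟨ *-monoˡ-≤-nonNeg x {{ℚ.nonNegative (0≤ℓ^ r n)}}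
           (*-monoˡ-≤-nonNeg y {{ℚ.nonNegative (0≤ℓ^ s n)}} (u⊛u≤ n)) ⟩
    x * (y * ((ℓ^ 2) n * u n))
      ≡⟨ solve 4 (λ x y z v → x :* (y :* (z :* v)) := x :* (y :* z) :* v) refl x y ((ℓ^ 2) n) (u n) ⟩
    x * (y * (ℓ^ 2) n) * u n
      ≡⟨ cong (_* u n) (trans (cong (x *_) (sym (ℓ^-+ s 2 n))) (sym (ℓ^-+ r (s ℕ.+ 2) n))) ⟩
    (ℓ^ (r ℕ.+ (s ℕ.+ 2))) n * u n ∎
    where
    x = (ℓ^ r) n
    y = (ℓ^ s) n
    ∣alternate∣≤ : ∀ m → m ℕ.≤ n → ∣ alternate a m ∣ ≤ x * u m
    ∣alternate∣≤ m m≤n = begin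
      ∣ sign m * a m ∣    ≡⟨ ∣sign*p∣ m (a m) ⟩
      ∣ a m ∣             ≤⟨ ∣a∣≤ m ⟩
      (ℓ^ r) m * u m      ≤⟨ *-mono (0≤u m) (0≤ℓ^ r n) (ℓ^-monotone r m≤n) ≤-refl ⟩
      x * u m             ∎
    ∣tail∣≤ : ∀ m → m ℕ.≤ n → ∣ eval b m - eval b n ∣ ≤ y * u m
    ∣tail∣≤ m m≤n = begin
      ∣ eval b m - eval b n ∣                   ≡⟨ ∣p-q∣≡∣q-p∣ (eval b m) (eval b n) ⟩
      ∣ eval b n - eval b m ∣                   ≡⟨ cong (λ k → ∣ eval b k - eval b m ∣) (sym (ℕ.m∸n+n≡m m≤n)) ⟩
      ∣ eval b (n ∸ m ℕ.+ m) - eval b m ∣       ≤⟨ tail m (n ∸ m) ⟩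
      (ℓ^ s) m * u m                            ≤⟨ *-mono (0≤u m) (0≤ℓ^ s n) (ℓ^-monotone s m≤n) ≤-refl ⟩
      y * u m                                   ∎

-- The powers of ln 2 as alternating sums.

-- Catalan's identity: with all signs negative the sum is minus `harmonic (m + m)`, and correcting
-- the even terms adds `2 / (2j) = 1 / j` for each `j ≤ m`.
zetaSum-bar1-even : ∀ m → zetaSum (bar 1 ∷ []) (m ℕ.+ m) ≡ harmonic m - harmonic (m ℕ.+ m)
zetaSum-bar1-even zero    = refl
zetaSum-bar1-even (suc m) = subst (λ k → z (suc k) ≡ harmonic (suc m) - harmonic (suc k)) (sym (ℕ.+-suc m m))
  (begin
    (z e + factor (bar 1) (suc e) * 1ℚ) + factor (bar 1) (suc (suc e)) * 1ℚ
      ≡⟨ cong₂ (λ s t → (z e + s * 1ℚ) + t * 1ℚ) (term e) (term (suc e)) ⟩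
    (z e + sign (suc e) * p * 1ℚ) + sign (suc (suc e)) * q * 1ℚ
      ≡⟨ cong₂ (λ s t → (z e + s * p * 1ℚ) + t * q * 1ℚ) sign-odd
           (trans (sign-suc (suc e)) (cong -_ sign-odd)) ⟩
    (z e + - 1ℚ * p * 1ℚ) + - - 1ℚ * q * 1ℚ
      ≡⟨ cong (λ t → (t + - 1ℚ * p * 1ℚ) + - - 1ℚ * q * 1ℚ) (zetaSum-bar1-even m) ⟩
    ((h - h′) + - 1ℚ * p * 1ℚ) + - - 1ℚ * q * 1ℚ
      ≡⟨ solve 4 (λ h h′ p q → ((h :- h′) :+ con (- 1ℚ) :* p :* con 1ℚ) :+ con (- - 1ℚ) :* q :* con 1ℚ
           := (h :+ (con 1ℚ :+ con 1ℚ) :* q) :- (h′ :+ p :+ q)) refl h h′ p q ⟩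
    (h + 2ℚ * q) - (h′ + p + q)
      ≡⟨ cong (λ t → (h + t) - (h′ + p + q)) double ⟩
    (h + u m) - (h′ + p + q) ∎)
  where
  open ≡-Reasoning
  z = zetaSum (bar 1 ∷ [])
  e = m ℕ.+ m
  h = harmonic m
  h′ = harmonic e
  p = u e
  q = u (suc e)
  term : ∀ n → factor (bar 1) (suc n) ≡ sign (suc n) * u n
  term n = trans (factor-bar 1 n) (cong (sign (suc n) *_) (trans (pow-suc 0 n) (*-identityʳ (u n))))
  sign-even : ∀ k → sign (k ℕ.+ k) ≡ 1ℚ
  sign-even zero    = refl
  sign-even (suc k) = trans (cong (sign ∘ suc) (ℕ.+-suc k k))
    (trans (sign-suc (suc (k ℕ.+ k)))
      (trans (cong -_ (trans (sign-suc (k ℕ.+ k)) (cong -_ (sign-even k)))) refl))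
  sign-odd : sign (suc e) ≡ - 1ℚ
  sign-odd = trans (sign-suc e) (cong -_ (sign-even m))
  double : 2ℚ * q ≡ u m
  double = trans
    (cong (λ k → 2ℚ * u k) (sym (trans (cong (m ℕ.+_) (ℕ.*-identityˡ (suc m))) (ℕ.+-suc m m))))
    (scaled-u 1 m)

-- `lnSum 2 n` is minus the alternating sum up to `2n + 2`, while `eval` stops at `n`; two partial
-- sums of one Cauchy sequence are compared.
ln2+eval-null : Null (λ n → seq (ln 2) n + eval (coeff (ones 1)) n)
ln2+eval-null ε 0<ε = go (zetaSum-cauchy (bar 1 ∷ []) _ ε 0<ε)
  where
  open ≡-Reasoning
  z : ℕ → ℚ
  z = zetaSum (bar 1 ∷ [])
  eq : ∀ n → z n - z (suc n ℕ.+ suc n) ≡ lnSum 2 n + eval (coeff (ones 1)) n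
  eq n = begin
    z n - z (suc n ℕ.+ suc n)
      ≡⟨ cong₂ _-_ (sym (eval-coeff 1 [] n)) (zetaSum-bar1-even (suc n)) ⟩
    e - (h - harmonic (suc n ℕ.+ suc n))
      ≡⟨ cong (λ k → e - (h - harmonic (suc n ℕ.+ k))) (sym (ℕ.+-identityʳ (suc n))) ⟩
    e - (h - h′)
      ≡⟨ solve 3 (λ e h h′ → e :- (h :- h′) := (h′ :- h) :+ e) refl e h h′ ⟩
    (h′ - h) + e
      ≡⟨ cong (_+ e) (sym (lnSum-harmonic 1 n)) ⟩
    lnSum 2 n + e ∎
    where
    e = eval (coeff (ones 1)) n
    h = harmonic (suc n)
    h′ = harmonic (2 ℕ.* suc n)
  go : (∃ λ N → ∀ m n → N ℕ.≤ m → N ℕ.≤ n → ∣ z m - z n ∣ < ε) →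
    ∃ λ N → ∀ n → N ℕ.≤ n → ∣ lnSum 2 n + eval (coeff (ones 1)) n ∣ < ε
  go (N , close) = N , λ n N≤n → subst (λ x → ∣ x ∣ < ε) (eq n)
    (close n (suc n ℕ.+ suc n) N≤n (ℕ.≤-trans N≤n (ℕ.m≤n⇒m≤1+n (ℕ.m≤m+n n (suc n)))))

seq-1/[1+i]! : ∀ i n → seq (1/ suc i !) n ≡ u i * seq (1/ i !) n
seq-1/[1+i]! i n = sym (/-*-/ (+ 1) (+ 1) (suc i) (i !) {{_}} {{i ℕ.!≢0}} {{suc i ℕ.!≢0}})

eval-scale : ∀ c {a b : Series} → (∀ m → a m ≡ c * b m) → ∀ n → eval a n ≡ c * eval b n
eval-scale c {a} {b} a≡cb n = trans
  (∑<-cong (λ m → trans (cong (sign m *_) (a≡cb m))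
    (solve 3 (λ s c x → s :* (c :* x) := c :* (s :* x)) refl (sign m) c (b m))) (suc n))
  (∑<-scale c (alternate b) (suc n))

-- Three errors make up the induction step: the previous power, `ln 2` against `- V 1`, and
-- `V 1 * V i` against `W`, which is `suc i` times `V (suc i)`. The factor `u i` divides by `suc i`.
ln2^/!-null : ∀ i → Null (λ n → seq (ln 2 ^ℝ i *ℝ 1/ i !) n - sign i * eval (coeff (ones i)) n)
ln2^/!-null zero    = null-cong {λ _ → 0ℚ}
  (λ n → sym (cong (λ t → 1ℚ * 1ℚ - 1ℚ * t) (eval-coeff-[] n))) null-0
ln2^/!-null (suc i) = null-cong regroup
  (null-scale (u i) (null-+
    (cauchy*null {L} (cauchy (ln 2)) (ln2^/!-null i))
    (null-+ (null-scale σ (cauchy*null {V i} (logConvergent⇒cauchy {V i} (ones-logConvergent i)) ln2+eval-null))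
            (null-scale σ (eval-⊛-null (coeff-logBounded (ones 1)) (ones-logConvergent i))))))
  where
  open ≡-Reasoning
  L : ℕ → ℚ
  L = seq (ln 2)
  V : ℕ → ℕ → ℚ
  V i = eval (coeff (ones i))
  W : ℕ → ℚ
  W = eval (coeff (ones 1) ⊛ coeff (ones i))
  σ = sign i
  regroup : ∀ n → u i * (L n * (seq (ln 2 ^ℝ i) n * seq (1/ i !) n - σ * V i n)
      + (σ * (V i n * (L n + V 1 n)) + σ * (W n - V 1 n * V i n)))
    ≡ seq (ln 2 ^ℝ suc i) n * seq (1/ suc i !) n - sign (suc i) * V (suc i) n
  regroup n = begin
    v * (l * (lⁱ * f - σ * V i n) + (σ * (V i n * (l + V 1 n)) + σ * (W n - V 1 n * V i n)))
      ≡⟨ solve 8 (λ v l lⁱ f s x y w → v :* (l :* (lⁱ :* f :- s :* x) :+ (s :* (x :* (l :+ y)) :+ s :* (w :- y :* x)))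
           := l :* lⁱ :* (v :* f) :- (:- s) :* (v :* w)) refl v l lⁱ f σ (V i n) (V 1 n) (W n) ⟩
    l * lⁱ * (v * f) - - σ * (v * W n)
      ≡⟨ cong (λ t → l * lⁱ * (v * f) - - σ * (v * t)) (eval-scale (+ suc i / 1) (1⊛ones i) n) ⟩
    l * lⁱ * (v * f) - - σ * (v * ((+ suc i / 1) * V (suc i) n))
      ≡⟨ cong₂ (λ s t → l * lⁱ * s - - σ * t) (sym (seq-1/[1+i]! i n)) (u*[1+n]* i (V (suc i) n)) ⟩
    l * lⁱ * seq (1/ suc i !) n - - σ * V (suc i) n
      ≡⟨ cong (λ s → l * lⁱ * seq (1/ suc i !) n - s * V (suc i) n) (sym (sign-suc i)) ⟩
    l * lⁱ * seq (1/ suc i !) n - sign (suc i) * V (suc i) n ∎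
    where
    v = u i
    l = L n
    lⁱ = seq (ln 2 ^ℝ i) n
    f = seq (1/ i !) n

-- From the series identity to the theorem.

-- Two replacements: the power of ln 2 by a signed value, then a product of values by the value of
-- the product. The case `s = 0` serves the summands, `s = 2` the `bar 3` term.
term-null : ∀ i s es → Null (λ n →
  seq (ln 2 ^ℝ i *ℝ 1/ i !) n * zetaSum (bar (suc s) ∷ es) n
    - sign i * eval (coeff (ones i) ⊛ coeff (plain (suc s) ∷ es)) n)
term-null i s es = null-cong
  (λ n → trans
    (solve 5 (λ p v y w g → y :* (p :- g :* v) :+ (:- g) :* (w :- v :* y) := p :* y :- g :* w) refl
      (seq (ln 2 ^ℝ i *ℝ 1/ i !) n) (eval a n) (eval b n) (eval (a ⊛ b) n) (sign i))
    (cong (λ y → seq (ln 2 ^ℝ i *ℝ 1/ i !) n * y - sign i * eval (a ⊛ b) n) (eval-coeff (suc s) es n)))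
  (null-+ (cauchy*null {eval b} (logConvergent⇒cauchy {eval b} (coeff-logConvergent s es)) (ln2^/!-null i))
          (null-scale (- sign i) (eval-⊛-null (coeff-logBounded (ones i)) (coeff-logConvergent s es))))
  where
  a b : Series
  a = coeff (ones i)
  b = coeff (plain (suc s) ∷ es)

∑-null : ∀ m {f : ℕ → ℝ} {g : ℕ → ℕ → ℚ} → (∀ i → Null (λ n → seq (f i) n - g i n)) →
  Null (λ n → seq (∑ℝ m f) n - ∑ℚ m (λ i → g i n))
∑-null zero            _ = null-0
∑-null (suc m) {f} {g} p = null-cong
  (λ n → solve 4 (λ x y z w → (x :- y) :+ (z :- w) := (x :+ z) :- (y :+ w)) refl
    (seq (∑ℝ m f) n) (∑ℚ m (λ i → g i n)) (seq (f (suc m)) n) (g (suc m) n))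
  (null-+ (∑-null m {f} {g} p) (p (suc m)))

-- x is kept variable: at the literal -1 type checking would unfold the
-- rational multiplication.
seq-[-1]^ : ∀ x n → seq x n ≡ - 1ℚ → ∀ k → seq (x ^ℝ k) n ≡ sign k
seq-[-1]^ x n x≡-1 zero    = refl
seq-[-1]^ x n x≡-1 (suc k) = begin
  seq x n * seq (x ^ℝ k) n  ≡⟨ cong₂ _*_ x≡-1 (seq-[-1]^ x n x≡-1 k) ⟩
  - 1ℚ * sign k             ≡⟨ sym (neg-distribˡ-* 1ℚ (sign k)) ⟩
  - (1ℚ * sign k)           ≡⟨ cong -_ (*-identityˡ (sign k)) ⟩
  - sign k                  ≡⟨ sym (sign-suc k) ⟩
  sign (suc k)              ∎
  where open ≡-Reasoning

∑<-+ : ∀ a b n → ∑< (λ m → a m + b m) n ≡ ∑< a n + ∑< b n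
∑<-+ a b zero    = refl
∑<-+ a b (suc n) = trans (cong (_+ (a n + b n)) (∑<-+ a b n))
  (solve 4 (λ x y z w → (x :+ y) :+ (z :+ w) := (x :+ z) :+ (y :+ w)) refl (∑< a n) (∑< b n) (a n) (b n))

eval-+ : ∀ a b n → eval (λ m → a m + b m) n ≡ eval a n + eval b n
eval-+ a b n = trans (∑<-cong (λ m → *-distribˡ-+ (sign m) (a m) (b m)) (suc n))
  (∑<-+ (alternate a) (alternate b) (suc n))

eval-0 : ∀ n → eval (λ _ → 0ℚ) n ≡ 0ℚ
eval-0 zero    = *-zeroʳ (sign 0)
eval-0 (suc n) = cong₂ _+_ (eval-0 n) (*-zeroʳ (sign (suc n)))

eval-∑ : ∀ j (c : ℕ → ℚ) (a : ℕ → Series) n →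
  eval (λ m → ∑ℚ j (λ i → c i * a i m)) n ≡ ∑ℚ j (λ i → c i * eval (a i) n)
eval-∑ zero    c a n = eval-0 n
eval-∑ (suc j) c a n = trans
  (eval-+ (λ m → ∑ℚ j (λ i → c i * a i m)) (λ m → c (suc j) * a (suc j) m) n)
  (cong₂ _+_ (eval-∑ j c a n) (eval-scale (c (suc j)) {b = a (suc j)} (λ _ → refl) n))

-- `eval` is linear, so `series-identity` survives truncation at each `n` without error.
eval-identity : ∀ k .{{_ : NonZero k}} n →
  eval (coeff (plain 1 ∷ ones (k ∸ 1) ++ plain 3 ∷ ones (k ∸ 1))) n ≡
  - ∑ℚ (k ∸ 1) (λ i → sign i * eval (coeff (ones i) ⊛ coeff (plain 1 ∷ ones (k ∸ i ∸ 1) ++ plain 3 ∷ ones (k ∸ 1))) n)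
    - sign k * eval (coeff (ones k) ⊛ coeff (plain 3 ∷ ones (k ∸ 1))) n
    + sign k * ½ * eval (coeff (plain 2 ∷ ones (k ∸ 1)) ⊛ coeff (plain 2 ∷ ones (k ∸ 1))) n
eval-identity (suc k′) n = begin
  eval (coeff (ones (suc k′) ++ plain 3 ∷ ones k′)) n
    ≡⟨ ∑<-cong (λ m → cong (sign m *_) (trans (series-identity k′ m)
         (solve 4 (λ x s y z → :- x :- s :* y :+ s :* (con ½ :* z)
           := (con (- 1ℚ) :* x :+ (:- s) :* y) :+ s :* con ½ :* z) refl (S m) g (x m) (z m)))) (suc n) ⟩
  eval (λ m → (- 1ℚ * S m + - g * x m) + g * ½ * z m) n
    ≡⟨ trans (eval-+ (λ m → - 1ℚ * S m + - g * x m) (λ m → g * ½ * z m) n)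
         (cong (_+ eval (λ m → g * ½ * z m) n) (eval-+ (λ m → - 1ℚ * S m) (λ m → - g * x m) n)) ⟩
  (eval (λ m → - 1ℚ * S m) n + eval (λ m → - g * x m) n) + eval (λ m → g * ½ * z m) n
    ≡⟨ cong₂ _+_ (cong₂ _+_ (eval-scale (- 1ℚ) {b = S} (λ _ → refl) n) (eval-scale (- g) {b = x} (λ _ → refl) n))
         (eval-scale (g * ½) {b = z} (λ _ → refl) n) ⟩
  (- 1ℚ * eval S n + - g * eval x n) + g * ½ * eval z n
    ≡⟨ cong (λ t → (- 1ℚ * t + - g * eval x n) + g * ½ * eval z n) (eval-∑ k′ sign y n) ⟩
  (- 1ℚ * T + - g * eval x n) + g * ½ * eval z n
    ≡⟨ solve 4 (λ x s y z → (con (- 1ℚ) :* x :+ (:- s) :* y) :+ s :* con ½ :* z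
         := :- x :- s :* y :+ s :* con ½ :* z) refl T g (eval x n) (eval z n) ⟩
  - T - g * eval x n + g * ½ * eval z n ∎
  where
  open ≡-Reasoning
  y : ℕ → Series
  y i = coeff (ones i) ⊛ coeff (ones (suc (suc k′ ∸ i ∸ 1)) ++ plain 3 ∷ ones k′)
  S x z : Series
  S m = ∑ℚ k′ (λ i → sign i * y i m)
  x = coeff (ones (suc k′)) ⊛ coeff (plain 3 ∷ ones k′)
  z = coeff (plain 2 ∷ ones k′) ⊛ coeff (plain 2 ∷ ones k′)
  g = sign (suc k′)
  T = ∑ℚ k′ (λ i → sign i * eval (y i) n)

corollary5p1 : (k : ℕ) .{{_ : NonZero k}} →
    ζ (bar 1 ∷ ones (k ∸ 1) ++ plain 3 ∷ ones (k ∸ 1))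
      ≃ℝ
    -ℝ ∑ℝ (k ∸ 1) (λ i →
         ln 2 ^ℝ i *ℝ 1/ i ! *ℝ ζ (bar 1 ∷ ones (k ∸ i ∸ 1) ++ plain 3 ∷ ones (k ∸ 1)))
      -ℝ ln 2 ^ℝ k *ℝ 1/ k ! *ℝ ζ (bar 3 ∷ ones (k ∸ 1))
      +ℝ (-ℝ fromℚ 1ℚ) ^ℝ k *ℝ fromℚ ½ *ℝ ζ (bar 2 ∷ ones (k ∸ 1)) ^ℝ 2
corollary5p1 k = null-cong {λ n → ∑-error n + (k-error n + square-error n)} {total} regroup
  (null-+ {∑-error} {λ n → k-error n + square-error n} ∑-error-null
    (null-+ {k-error} {square-error} (term-null k 2 (ones (k ∸ 1))) square-error-null))
  where
  open ≡-Reasoning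
  g = sign k
  R : ℕ → ℝ
  R i = ln 2 ^ℝ i *ℝ 1/ i ! *ℝ ζ (bar 1 ∷ ones (k ∸ i ∸ 1) ++ plain 3 ∷ ones (k ∸ 1))
  y : ℕ → Series
  y i = coeff (ones i) ⊛ coeff (plain 1 ∷ ones (k ∸ i ∸ 1) ++ plain 3 ∷ ones (k ∸ 1))
  x d : Series
  x = coeff (ones k) ⊛ coeff (plain 3 ∷ ones (k ∸ 1))
  d = coeff (plain 2 ∷ ones (k ∸ 1))
  ∑-error k-error square-error : ℕ → ℚ
  ∑-error n = seq (∑ℝ (k ∸ 1) R) n - ∑ℚ (k ∸ 1) (λ i → sign i * eval (y i) n)
  k-error n = seq (ln 2 ^ℝ k *ℝ 1/ k !) n * zetaSum (bar 3 ∷ ones (k ∸ 1)) n - g * eval x n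
  square-error n = g * ½ * (eval (d ⊛ d) n - eval d n * eval d n)
  ∑-error-null : Null ∑-error
  ∑-error-null = ∑-null (k ∸ 1) {R} {λ i n → sign i * eval (y i) n}
    (λ i → term-null i 0 (ones (k ∸ i ∸ 1) ++ plain 3 ∷ ones (k ∸ 1)))
  square-error-null : Null square-error
  square-error-null = null-scale (g * ½)
    (eval-⊛-null (coeff-logBounded (plain 2 ∷ ones (k ∸ 1))) (coeff-logConvergent 1 (ones (k ∸ 1))))
  -- The difference of the two sides, unfolded; the trailing `1ℚ` comes from `_^ℝ 2`.
  total : ℕ → ℚ
  total n = zetaSum (bar 1 ∷ ones (k ∸ 1) ++ plain 3 ∷ ones (k ∸ 1)) n
      - (- seq (∑ℝ (k ∸ 1) R) n - seq (ln 2 ^ℝ k *ℝ 1/ k !) n * zetaSum (bar 3 ∷ ones (k ∸ 1)) n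
        + seq ((-ℝ fromℚ 1ℚ) ^ℝ k) n * ½ * (zetaSum (bar 2 ∷ ones (k ∸ 1)) n * (zetaSum (bar 2 ∷ ones (k ∸ 1)) n * 1ℚ)))
  -- By `eval-identity` the difference of the two sides consists exactly of the three replacement
  -- errors.
  regroup : ∀ n → ∑-error n + (k-error n + square-error n) ≡ total n
  regroup n = begin
    (r - T) + ((p - g * eval x n) + g * ½ * (eval (d ⊛ d) n - v * v))
      ≡⟨ solve 7 (λ r T p g x w v → (r :- T) :+ ((p :- g :* x) :+ g :* con ½ :* (w :- v :* v))
           := (:- T :- g :* x :+ g :* con ½ :* w) :- (:- r :- p :+ g :* con ½ :* (v :* (v :* con 1ℚ)))) refl
           r T p g (eval x n) (eval (d ⊛ d) n) v ⟩
    (- T - g * eval x n + g * ½ * eval (d ⊛ d) n) - (- r - p + g * ½ * (v * (v * 1ℚ)))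
      ≡⟨ cong₂ (λ s v → s - (- r - p + g * ½ * (v * (v * 1ℚ))))
           (trans (sym (eval-identity k n)) (eval-coeff 1 (ones (k ∸ 1) ++ plain 3 ∷ ones (k ∸ 1)) n))
           (eval-coeff 2 (ones (k ∸ 1)) n) ⟩
    z₁ - (- r - p + g * ½ * (z₂ * (z₂ * 1ℚ)))
      ≡⟨ cong (λ s → z₁ - (- r - p + s * ½ * (z₂ * (z₂ * 1ℚ)))) (sym (seq-[-1]^ (-ℝ fromℚ 1ℚ) n refl k)) ⟩
    z₁ - (- r - p + seq ((-ℝ fromℚ 1ℚ) ^ℝ k) n * ½ * (z₂ * (z₂ * 1ℚ))) ∎
    where
    r = seq (∑ℝ (k ∸ 1) R) n
    T = ∑ℚ (k ∸ 1) (λ i → sign i * eval (y i) n)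
    p = seq (ln 2 ^ℝ k *ℝ 1/ k !) n * zetaSum (bar 3 ∷ ones (k ∸ 1)) n
    v = eval d n
    z₁ = zetaSum (bar 1 ∷ ones (k ∸ 1) ++ plain 3 ∷ ones (k ∸ 1)) n
    z₂ = zetaSum (bar 2 ∷ ones (k ∸ 1)) n
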